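{- Let $n,k,r$ be integers such that either $k=1$ and $2\le r\le n-3$, or $k\ge 2$, $r\ge 2$ and $kr\le n-2$. If $T$ is a tree of order $n$ with $k$ pendent paths of length $r$ that has maximum Mostar index among all such trees, then $T\cong S^r_{n,k}$.
   Context: For a connected simple graph $G$, the Mostar index is $Mo(G)=\sum_{uv\in E(G)}|n_u-n_v|$, where for an edge $e=uv$, $n_u$ is the number of vertices of $G$ closer (in graph distance) to $u$ than to $v$, and $n_v$ is the number of vertices closer to $v$ than to $u$. The order of a graph is its number of vertices. A path $u_0u_1\cdots u_r$ with $r\ge1$ in a graph $G$ is called a pendent path of length $r$ at $u_r$ if $d_G(u_0)=1$, $d_G(u_r)\ge 2$ and, when $r\ge 2$, $d_G(u_i)=2$ for $1\le i\le r-1$. (Note that $u_r$ may have degree exactly $2$.) "With $k$ pendent paths of length $r$" means that the number of pendent paths of length $r$ is exactly $k$. For $k=1$ and $2\le r\le n-3$, or $k\ge2$, $r\ge2$ and $kr\le n-2$, $S^r_{n,k}$ is the $n$-vertex tree consisting of $k$ pendent paths of length $r$ and $n-kr-1$ pendent paths of length one, all attached at a common vertex. -}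

module Defs where

open import Data.Nat using (ℕ; zero; suc; _+_; _*_; _∸_; _≤_; _<_; z≤n; s≤s; _<?_; ∣_-_∣)
import Data.Nat as ℕ
open import Data.Nat.ListAction using (sum)
open import Data.Nat.Properties using (1+n≢n)
open import Data.Fin using (Fin; toℕ)
import Data.Fin as Fin
open import Data.Fin.Properties using (any?)
open import Data.List using (List; length; filter; map; allFin; cartesianProduct)
open import Data.Product using (∃; _×_; _,_; proj₁; uncurry)
open import Data.Sum using (inj₁; inj₂)
open import Data.Vec using (Vec; head; last; lookup)
open import Data.Vec.Relation.Unary.Linked using (Linked)
open import Data.Vec.Relation.Unary.Unique.Propositional using (Unique)
open import Function.Bundles using (_⇔_; _↔_; module Inverse)
open import Function.Definitions using (Injective)
open import Level using (0ℓ)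
open import Relation.Binary.Construct.Closure.Symmetric using (SymClosure; fwd; bwd; symmetric)
open import Relation.Binary.Core using (Rel)
open import Relation.Binary.Definitions using (Symmetric; Irreflexive; Decidable)
open import Relation.Binary.PropositionalEquality using (_≡_; refl; sym)
open import Relation.Nullary using (¬_; Dec; yes; no; contradiction)
open import Relation.Nullary.Decidable using (map′; _×-dec_; _⊎-dec_)
import Relation.Unary as U

record SimpleGraph (V : Set) : Set₁ where
  infix 4 _∼_ _∼?_
  field
    _∼_      : Rel V 0ℓ
    ∼-sym    : Symmetric _∼_
    ∼-irrefl : Irreflexive _≡_ _∼_
    _∼?_     : Decidable _∼_

infix 4 _≅_

record _≅_ {V W : Set} (G : SimpleGraph V) (H : SimpleGraph W) : Set where
  private
    module G = SimpleGraph G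
    module H = SimpleGraph H
  field
    bijection : V ↔ W
    adjacent  : ∀ u v → (u G.∼ v) ⇔ (Inverse.to bijection u H.∼ Inverse.to bijection v)

module _ {V : Set} (G : SimpleGraph V) where
  open SimpleGraph G

  data Walk : ℕ → V → V → Set where
    []  : ∀ {u} → Walk 0 u u
    _∷_ : ∀ {l u v w} → u ∼ v → Walk l v w → Walk (suc l) u w

  Connected : Set
  Connected = ∀ u v → ∃ λ l → Walk l u v

  IsPath : ∀ {m} → Vec V m → Set
  IsPath p = Linked _∼_ p × Unique p

  -- A cycle is a path on at least three vertices whose ends are adjacent.
  Acyclic : Set
  Acyclic = ∀ {m} (p : Vec V (3 + m)) → IsPath p → ¬ (last p ∼ head p)

record Tree (n : ℕ) : Set₁ where
  field
    graph     : SimpleGraph (Fin n)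
    connected : Connected graph
    acyclic   : Acyclic graph

IsLeast : (ℕ → Set) → ℕ → Set
IsLeast P m = P m × (∀ j → P j → m ≤ j)

least : {P : ℕ → Set} → U.Decidable P → ∃ P → ∃ (IsLeast P)
least {P} P? (d , pd) = go P? d pd
  where
  go : {Q : ℕ → Set} → U.Decidable Q → ∀ e → Q e → ∃ (IsLeast Q)
  go Q? e q with Q? 0
  go Q? e       q | yes q₀ = 0 , q₀ , λ _ _ → z≤n
  go Q? zero    q | no ¬q₀ = contradiction q ¬q₀
  go Q? (suc e) q | no ¬q₀ with go (λ j → Q? (suc j)) e q
  ... | m , qm , min = suc m , qm , λ where
    zero    q₀ → contradiction q₀ ¬q₀
    (suc j) qj → s≤s (min j qj)

module _ {n : ℕ} (G : SimpleGraph (Fin n)) where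
  open SimpleGraph G

  walk? : ∀ l u v → Dec (Walk G l u v)
  walk? zero    u v = map′ (λ where refl → []) (λ where [] → refl) (u Fin.≟ v)
  walk? (suc l) u v =
    map′ (λ where (_ , a , p) → a ∷ p) (λ where (a ∷ p) → _ , a , p)
      (any? λ w → (u ∼? w) ×-dec walk? l w v)

  count : {P : Fin n → Set} → U.Decidable P → ℕ
  count P? = length (filter P? (allFin n))

  degree : Fin n → ℕ
  degree u = count (u ∼?_)

  -- Each edge is listed once, with its smaller end first.
  edges : List (Fin n × Fin n)
  edges = filter (uncurry λ u v → (u Fin.<? v) ×-dec (u ∼? v))
                 (cartesianProduct (allFin n) (allFin n))

  module _ (connected : Connected G) where

    dist : Fin n → Fin n → ℕ
    dist u v = proj₁ (least (λ l → walk? l u v) (connected u v))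

    closer : Fin n → Fin n → ℕ
    closer u v = count (λ w → dist w u <? dist w v)

    mostar : ℕ
    mostar = sum (map (uncurry λ u v → ∣ closer u v - closer v u ∣) edges)

  -- The degrees of its ends determine the direction of a pendent path, so
  -- pendent paths correspond one-to-one to such vertex sequences u₀ u₁ ⋯ uᵣ.
  record IsPendentPath {r : ℕ} (u : Vec (Fin n) (suc r)) : Set where
    field
      isPath   : IsPath G u
      start    : degree (head u) ≡ 1
      end      : 2 ≤ degree (last u)
      internal : ∀ (i : Fin (suc r)) → 1 ≤ toℕ i → toℕ i < r → degree (lookup u i) ≡ 2

record Exactly (k : ℕ) {A : Set} (P : A → Set) : Set where
  field
    enum           : Fin k → A
    enum-injective : Injective _≡_ _≡_ enum
    enum-image     : ∀ x → P x ⇔ (∃ λ i → enum i ≡ x)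

treeMostar : ∀ {n} → Tree n → ℕ
treeMostar T = mostar (Tree.graph T) (Tree.connected T)

HasPendentPaths : ∀ {n} (k r : ℕ) → Tree n → Set
HasPendentPaths k r T = Exactly k (IsPendentPath (Tree.graph T) {r})

IsMostarMaximal : ∀ {n} (k r : ℕ) → Tree n → Set₁
IsMostarMaximal {n} k r T =
  HasPendentPaths k r T ×
  (∀ (T′ : Tree n) → HasPendentPaths k r T′ → treeMostar T′ ≤ treeMostar T)

-- arm j i is the vertex at distance suc (toℕ i) from the centre on the j-th
-- path of length r.  There are n vertices as soon as k * r + 1 ≤ n.
data SVertex (n k r : ℕ) : Set where
  centre : SVertex n k r
  arm    : Fin k → Fin r → SVertex n k r
  leaf   : Fin (n ∸ k * r ∸ 1) → SVertex n k r

data SEdge {n k r : ℕ} : Rel (SVertex n k r) 0ℓ where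
  centre–arm  : ∀ {j i} → toℕ i ≡ 0 → SEdge centre (arm j i)
  arm–arm     : ∀ {j i i′} → toℕ i′ ≡ suc (toℕ i) → SEdge (arm j i) (arm j i′)
  centre–leaf : ∀ {l} → SEdge centre (leaf l)

SEdge? : ∀ {n k r} → Decidable (SEdge {n} {k} {r})
SEdge? centre    centre      = no λ ()
SEdge? centre    (arm j i)   = map′ centre–arm (λ where (centre–arm e) → e) (toℕ i ℕ.≟ 0)
SEdge? centre    (leaf _)    = yes centre–leaf
SEdge? (arm _ _) centre      = no λ ()
SEdge? (arm j i) (arm j′ i′) =
  map′ (λ where (refl , e) → arm–arm e) (λ where (arm–arm e) → refl , e)
    ((j Fin.≟ j′) ×-dec (toℕ i′ ℕ.≟ suc (toℕ i)))
SEdge? (arm _ _) (leaf _)    = no λ ()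
SEdge? (leaf _)  _           = no λ ()

SEdge-irrefl : ∀ {n k r} {u : SVertex n k r} → ¬ SEdge u u
SEdge-irrefl (arm–arm e) = 1+n≢n (sym e)

S : (n k r : ℕ) → SimpleGraph (SVertex n k r)
S n k r = record
  { _∼_      = SymClosure SEdge
  ; ∼-sym    = symmetric SEdge
  ; ∼-irrefl = λ where
      refl (fwd e) → SEdge-irrefl e
      refl (bwd e) → SEdge-irrefl e
  ; _∼?_     = λ u v →
      map′ (λ where (inj₁ e) → fwd e
                    (inj₂ e) → bwd e)
           (λ where (fwd e) → inj₁ e
                    (bwd e) → inj₂ e)
        (SEdge? u v ⊎-dec SEdge? v u)
  }

{-# OPTIONS --safe #-}
module Submission where

-- Write Mo as a sum of imbalances |n_u − n_v| over the edges.  On the i-th edge of a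
-- pendent path the imbalance is |i − (n − i)| in every tree, since one side of the edge
-- consists of the first i vertices of the path.  On any other edge it is at most n − 2,
-- with equality only when an end of the edge is a leaf.  In S all other edges are pendent,
-- so in a maximal tree they are pendent too.  To compare the sums term by term, root both
-- trees at the end of a pendent path: edges then correspond to non-root vertices, each
-- joined to its parent, and the vertices of both trees are labelled by SVertex n k r.

open import Defs
open import Data.Fin as Fin using (Fin; toℕ; zero; suc)
import Data.Fin.Properties as Fin
open import Data.List as List using (List; []; _∷_; length; filter; map; allFin; _++_; cartesianProduct)
open import Data.List.Membership.Propositional using (_∈_; _∉_)
open import Data.List.Membership.Propositional.Properties
  using (∈-lookup; ∈-allFin; ∈-map⁺; ∈-map⁻; ∈-filter⁺; ∈-filter⁻; ∈-++⁺ˡ; ∈-++⁺ʳ; ∈-++⁻; ∈-cartesianProduct⁺)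
open import Data.List.Membership.Propositional.Properties.WithK using (unique∧set⇒bag)
import Data.List.Membership.Setoid.Properties as SetoidMembership
open import Data.List.Properties using (length-tabulate; length-++; length-map; map-∘; map-cong)
open import Data.List.Relation.Binary.BagAndSetEquality using (∼bag⇒↭)
open import Data.List.Relation.Binary.Permutation.Propositional using (_↭_)
import Data.List.Relation.Binary.Permutation.Propositional.Properties as Perm
open import Data.List.Relation.Unary.All as All using (All; []; _∷_)
open import Data.List.Relation.Unary.All.Properties using (¬Any⇒All¬)
open import Data.List.Relation.Unary.AllPairs using ([]; _∷_)
open import Data.List.Relation.Unary.Any as Any using (here; there; index)
open import Data.List.Relation.Unary.Any.Properties using (lookup-index)
open import Data.List.Relation.Unary.Unique.Propositional using (Unique)
import Data.List.Relation.Unary.Unique.Propositional.Properties as Unique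
open import Data.Nat using (ℕ; zero; suc; _+_; _*_; _∸_; _≤_; _<_; z≤n; s≤s; s≤s⁻¹; _<?_; ∣_-_∣)
open import Data.Nat.ListAction using (sum)
open import Data.Nat.ListAction.Properties using (sum-↭)
open import Data.Nat.Properties
open import Data.Product using (Σ; ∃; _×_; _,_; proj₁; proj₂; uncurry)
open import Data.Sum using (_⊎_; inj₁; inj₂)
open import Data.Vec as Vec using (Vec; []; _∷_; head; last; lookup)
open import Data.Vec.Properties using (tabulate∘lookup; tabulate-cong; lookup∘tabulate)
import Data.Vec.Relation.Unary.All as VecAll
open import Data.Vec.Relation.Unary.All using ([]; _∷_)
open import Data.Vec.Relation.Unary.AllPairs using ([]; _∷_)
import Data.Vec.Relation.Unary.Any as VecAny
open import Data.Vec.Relation.Unary.Any using (here; there)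
open import Data.Vec.Relation.Unary.Linked as Linked using (Linked; []; [-]; _∷_)
import Data.Vec.Relation.Unary.Unique.Propositional.Properties as VecUnique
open import Function using (_∘_; id; Equivalence; mk⇔; _↔_; Inverse; mk↔ₛ′; mk⤖)
open import Function.Consequences.Propositional using (strictlySurjective⇒surjective)
open import Function.Definitions using (Injective)
open import Function.Properties.Bijection using (⤖⇒↔)
open import Function.Properties.Inverse using (↔-sym)
open import Relation.Binary.Construct.Closure.ReflexiveTransitive using (Star; ε; _◅_; _◅◅_; reverse)
open import Relation.Binary.Construct.Closure.Symmetric using (SymClosure; fwd; bwd)
open import Relation.Binary.Definitions using (tri<; tri≈; tri>)
open import Relation.Binary.PropositionalEquality
open import Relation.Nullary using (¬_; Dec; yes; no; contradiction)
open import Relation.Nullary.Decidable using (decidable-stable; ¬?; _×-dec_)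
import Relation.Unary as U

-- The labelling of an arbitrary tree need not follow its shape: pendent paths may end at different
-- vertices, and leaf labels go to all vertices that remain. Non-branching of the arms suffices for
-- the comparison. Once the leaf-labelled vertices are known to be childless, they and the inner
-- ends of the arms have only the root left as parent, which makes the tree a star.
--
-- The root has to satisfy two conditions. It must not occur before the end of any pendent path, so
-- that each of them leads from its start towards the root; and its degree must be at least two,
-- since an edge at a root of degree one has imbalance `n - 2` whatever hangs below it. The end of a
-- pendent path has both properties. For the first, overlaps must be excluded, such as those of two
-- long pendent paths in a path graph; this is where `k * r < n` enters.
--
-- The star must also be a legitimate competitor, with exactly `k` pendent paths of length `r`. The
-- conditions on `n`, `k`, `r` give its centre degree at least three, so no pendent path continues
-- through the centre, and `2 ≤ r` keeps the edges to the leaves from being counted.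

module _ {A : Set} where

  list-lookup-injective : ∀ {xs : List A} → Unique xs → Injective _≡_ _≡_ (List.lookup xs)
  list-lookup-injective (_ ∷ _)   {zero}  {zero}  _ = refl
  list-lookup-injective (x∉ ∷ _)  {zero}  {suc j} e =
    contradiction e (All.lookup x∉ (∈-lookup j))
  list-lookup-injective (x∉ ∷ _)  {suc i} {zero}  e =
    contradiction (sym e) (All.lookup x∉ (∈-lookup i))
  list-lookup-injective (_ ∷ xs!) {suc i} {suc j} e =
    cong suc (list-lookup-injective xs! e)

  -- Sending a position in `xs` to a position of the same element in `ys` is injective, so the
  -- pigeonhole principle for `Fin` applies.
  unique-length-≤ : ∀ {xs ys : List A} → Unique xs → (∀ {x} → x ∈ xs → x ∈ ys) →
                    length xs ≤ length ys
  unique-length-≤ {xs} xs! xs⊆ys = Fin.injective⇒≤ {f = λ i → index (xs⊆ys (∈-lookup i))} λ {i} {j} e →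
    list-lookup-injective xs!
      (SetoidMembership.index-injective (setoid A) (xs⊆ys (∈-lookup {xs = xs} i)) (xs⊆ys (∈-lookup j)) e)

-- Counting vertices by duplicate-free lists

module _ {n : ℕ} (G : SimpleGraph (Fin n)) where

  module _ {P : Fin n → Set} (P? : U.Decidable P) where

    count-≥ : ∀ {xs} → Unique xs → (∀ {x} → x ∈ xs → P x) → length xs ≤ count G P?
    count-≥ xs! xs⊆P = unique-length-≤ xs! λ x∈ → ∈-filter⁺ P? (∈-allFin _) (xs⊆P x∈)

    count-≤ : ∀ {xs} → (∀ {x} → P x → x ∈ xs) → count G P? ≤ length xs
    count-≤ P⊆xs = unique-length-≤ (Unique.filter⁺ P? (Unique.allFin⁺ n))
      λ x∈ → P⊆xs (proj₂ (∈-filter⁻ P? {xs = allFin n} x∈))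

    count-≡ : ∀ {xs} → Unique xs → (∀ {x} → x ∈ xs → P x) → (∀ {x} → P x → x ∈ xs) →
              count G P? ≡ length xs
    count-≡ xs! xs⊆P P⊆xs = ≤-antisym (count-≤ P⊆xs) (count-≥ xs! xs⊆P)

    -- A further element would extend `xs` beyond the bound. In this way a degree together with
    -- enough known neighbours determines all neighbours.
    count-saturated : ∀ {xs} → Unique xs → (∀ {x} → x ∈ xs → P x) → count G P? ≤ length xs →
                      ∀ {y} → P y → y ∈ xs
    count-saturated {xs} xs! xs⊆P bound {y} Py =
      decidable-stable (Any.any? (y Fin.≟_) xs) λ y∉xs →
        <⇒≱ (count-≥ {y ∷ xs} (¬Any⇒All¬ xs y∉xs ∷ xs!) λ where
              (here refl) → Py
              (there x∈)  → xs⊆P x∈)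
            bound

  length-allFin : length (allFin n) ≡ n
  length-allFin = length-tabulate id

  module _ {P Q : Fin n → Set} (P? : U.Decidable P) (Q? : U.Decidable Q)
           (disjoint : ∀ {x} → P x → ¬ Q x) where

    private
      both  = filter P? (allFin n) ++ filter Q? (allFin n)

      both! : Unique both
      both! = Unique.++⁺ (Unique.filter⁺ P? (Unique.allFin⁺ n)) (Unique.filter⁺ Q? (Unique.allFin⁺ n))
        λ (x∈P , x∈Q) → disjoint (proj₂ (∈-filter⁻ P? {xs = allFin n} x∈P)) (proj₂ (∈-filter⁻ Q? {xs = allFin n} x∈Q))

      length-both : length both ≡ count G P? + count G Q?
      length-both = length-++ (filter P? (allFin n))

    count-disjoint : count G P? + count G Q? ≤ n
    count-disjoint = subst₂ _≤_ length-both length-allFin (unique-length-≤ both! λ _ → ∈-allFin _)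

    count-complement : (∀ x → ¬ P x → Q x) → count G P? + count G Q? ≡ n
    count-complement cover = ≤-antisym count-disjoint
      (subst₂ _≤_ length-allFin length-both (unique-length-≤ (Unique.allFin⁺ n) λ {x} _ → split x))
      where
      split : ∀ x → x ∈ both
      split x with P? x
      ... | yes Px = ∈-++⁺ˡ (∈-filter⁺ P? (∈-allFin x) Px)
      ... | no ¬Px = ∈-++⁺ʳ _ (∈-filter⁺ Q? (∈-allFin x) (cover x ¬Px))

-- Walks, paths and cycles

module _ {V : Set} (G : SimpleGraph V) where
  open SimpleGraph G

  walk-++ : ∀ {l m u v w} → Walk G l u v → Walk G m v w → Walk G (l + m) u w
  walk-++ []      q = q
  walk-++ (a ∷ p) q = a ∷ walk-++ p q

  walk-reverse : ∀ {l u v} → Walk G l u v → Walk G l v u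
  walk-reverse []              = []
  walk-reverse {suc l} {u} {v} (a ∷ p) =
    subst (λ m → Walk G m v u) (+-comm l 1) (walk-++ (walk-reverse p) (∼-sym a ∷ []))

  path-tail : ∀ {m x} {p : Vec V m} → IsPath G (x ∷ p) → IsPath G p
  path-tail (linked , _ ∷ unique) = Linked.tail linked , unique

  -- A step in the graph with `x` deleted. Both ends are required to differ from `x`, so that walks
  -- of such steps can be reversed.
  Avoiding : V → V → V → Set
  Avoiding x u v = x ≢ u × u ∼ v × x ≢ v

  record PathAvoiding (x a b : V) : Set where
    constructor mkPath
    field
      {size}   : ℕ
      vertices : Vec V (suc size)
      start    : head vertices ≡ a
      end      : last vertices ≡ b
      isPath   : IsPath G vertices
      avoids   : VecAll.All (x ≢_) vertices

  path-from : ∀ {m x a} (p : Vec V (suc m)) → IsPath G p → VecAll.All (x ≢_) p →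
              VecAny.Any (a ≡_) p → PathAvoiding x a (last p)
  path-from p             path av       (here a≡)              = mkPath p (sym a≡) refl path av
  path-from (_ ∷ p@(_ ∷ _)) path (_ ∷ av) (there a∈)             = path-from p (path-tail path) av a∈

  module _ (_≟_ : (u v : V) → Dec (u ≡ v)) where

    -- Shorten the tail of the walk to a path first. If `a` already lies on it, the part before `a`
    -- is dropped; otherwise `a` is prepended.
    walk⇒path : ∀ {x a b} → x ≢ a → Star (Avoiding x) a b → PathAvoiding x a b
    walk⇒path x≢a ε = mkPath (_ ∷ []) refl refl ([-] , [] ∷ []) (x≢a ∷ [])
    walk⇒path {a = a} x≢a ((_ , a∼c , x≢c) ◅ walk)
      with walk⇒path x≢c walk
    ... | mkPath p@(_ ∷ _) start end path av with VecAny.any? (a ≟_) p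
    ...   | yes a∈p = subst (PathAvoiding _ a) end (path-from p path av a∈p)
    ...   | no  a∉p = mkPath (a ∷ p) refl end
                (subst (a ∼_) (sym start) a∼c ∷ proj₁ path , fresh p a∉p ∷ proj₂ path) (x≢a ∷ av)
      where
      fresh : ∀ {m} (q : Vec V m) → ¬ VecAny.Any (a ≡_) q → VecAll.All (a ≢_) q
      fresh []      _  = []
      fresh (_ ∷ q) a∉ = (a∉ ∘ here) ∷ fresh q (a∉ ∘ there)

    -- Otherwise the detour, cut down to a path, would close up to a cycle through x.
    neighbours-separated : Acyclic G → ∀ {x a b} → x ∼ a → x ∼ b → a ≢ b → ¬ Star (Avoiding x) a b
    neighbours-separated acyclic {x} {a} {b} x∼a x∼b a≢b walk
      with walk⇒path (λ { refl → ∼-irrefl refl x∼a }) walk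
    ... | mkPath (_ ∷ [])        start end _    _  = a≢b (trans (sym start) end)
    ... | mkPath p@(_ ∷ _ ∷ _) start end path av =
      acyclic (x ∷ p) (subst (x ∼_) (sym start) x∼a ∷ proj₁ path , av ∷ proj₂ path)
        (subst (_∼ x) (sym end) (∼-sym x∼b))

-- Rooted trees and distances

-- Equivalent to being a tree with a chosen root: `height` makes iterated parents reach the root,
-- and `adjacent⇒parent` excludes all other edges. As `height` need not be defined through `dist`,
-- the star can be presented this way directly, and its connectedness and acyclicity follow.
record Rooted {V : Set} (G : SimpleGraph V) : Set where
  open SimpleGraph G
  field
    root             : V
    parent           : V → V
    height           : V → ℕ
    parent-root      : parent root ≡ root
    parent-adjacent  : ∀ {v} → v ≢ root → v ∼ parent v
    height-parent    : ∀ {v} → v ≢ root → height v ≡ suc (height (parent v))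
    adjacent⇒parent  : ∀ {u v} → u ∼ v → (u ≢ root × parent u ≡ v) ⊎ (v ≢ root × parent v ≡ u)

  parent-≢ : ∀ {v} → v ≢ root → parent v ≢ v
  parent-≢ v≢ e = 1+n≢n (sym (trans (height-parent v≢) (cong (suc ∘ height) e)))

  -- Two vertices are thus never each other's parents, so an edge has a unique lower end.
  grandparent-≢ : ∀ {v} → v ≢ root → parent (parent v) ≢ v
  grandparent-≢ {v} v≢ e = m≢1+n+m (height v)
    (trans (height-parent v≢) (cong suc (trans (height-parent pv≢) (cong (suc ∘ height) e))))
    where
    pv≢ : parent v ≢ root
    pv≢ pv≡ = v≢ (trans (sym e) (trans (cong parent pv≡) parent-root))

module _ {n : ℕ} (G : SimpleGraph (Fin n)) (connected : Connected G) where
  open SimpleGraph G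

  private
    d : Fin n → Fin n → ℕ
    d = dist G connected

  dist-walk : ∀ u v → Walk G (d u v) u v
  dist-walk u v = proj₁ (proj₂ (least (λ l → walk? G l u v) (connected u v)))

  dist-≤ : ∀ {l u v} → Walk G l u v → d u v ≤ l
  dist-≤ {l} {u} {v} = proj₂ (proj₂ (least (λ l → walk? G l u v) (connected u v))) l

  dist-refl : ∀ u → d u u ≡ 0
  dist-refl u = n≤0⇒n≡0 (dist-≤ {u = u} [])

  dist-positive : ∀ {u v} → u ≢ v → 0 < d u v
  dist-positive {u} {v} u≢v with d u v | dist-walk u v
  ... | zero  | []    = contradiction refl u≢v
  ... | suc _ | _     = s≤s z≤n

  -- A walk from `P` to `w` must leave `P`, and it can do so only from `v`. Stopping it at its first
  -- exit gives the shorter walk.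
  shortcut : ∀ {P : Fin n → Set} (P? : U.Decidable P) {v w} → P v → ¬ P w →
             (∀ {x y} → x ∼ y → P x → ¬ P y → x ≡ v) →
             ∀ {l x} → P x → Walk G l x w → ∃ λ l′ → l′ < l × Walk G l′ x v
  shortcut P? Pv ¬Pw exit Px []                    = contradiction Px ¬Pw
  shortcut P? Pv ¬Pw exit Px (_∷_ {v = y} x∼y p) with P? y
  ... | no ¬Py with refl ← exit x∼y Px ¬Py = 0 , s≤s z≤n , []
  ... | yes Py with shortcut P? Pv ¬Pw exit Py p
  ...   | l′ , l′<l , q = suc l′ , s≤s l′<l , x∼y ∷ q

  module _ {xs : List (Fin n)} (xs! : Unique xs) {v w : Fin n} (v∈ : v ∈ xs) (w∉ : w ∉ xs)
           (cut : ∀ {x y} → x ∼ y → x ∈ xs → y ∉ xs → x ≡ v × y ≡ w) where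

    private
      inside? : U.Decidable (_∈ xs)
      inside? x = Any.any? (x Fin.≟_) xs

      inside : ∀ {x} → x ∈ xs → d x v < d x w
      inside x∈ with shortcut inside? v∈ w∉ (λ a x∈ y∉ → proj₁ (cut a x∈ y∉)) x∈ (dist-walk _ w)
      ... | _ , l< , p = ≤-<-trans (dist-≤ p) l<

      outside : ∀ {x} → x ∉ xs → d x w < d x v
      outside x∉ with shortcut (¬? ∘ inside?) w∉ (λ v∉ → v∉ v∈)
                        (λ a x∉ ¬y∉ → proj₂ (cut (∼-sym a) (decidable-stable (inside? _) ¬y∉) x∉))
                        x∉ (dist-walk _ v)
      ... | _ , l< , p = ≤-<-trans (dist-≤ p) l<

      closer-inside : closer G connected v w ≡ length xs
      closer-inside = count-≡ G (λ x → d x v <? d x w) xs! inside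
        λ {x} lt → decidable-stable (inside? x) λ x∉ → <-asym lt (outside x∉)

      closer-outside : closer G connected w v ≡ n ∸ length xs
      closer-outside = trans (sym (m+n∸m≡n (closer G connected v w) _))
        (cong₂ _∸_ (count-complement G (λ x → d x v <? d x w) (λ x → d x w <? d x v) <-asym
                      (λ x ≮ → outside {x} (λ x∈ → ≮ (inside {x} x∈))))
                   closer-inside)

    -- The edge from `v` to `w` is the only one leaving `xs`. Vertices in `xs` reach `w` only by way
    -- of `v`, and the others reach `v` only by way of `w`, so the two sides of the edge are `xs`
    -- and its complement.
    mostar-cut : ∣ closer G connected v w - closer G connected w v ∣ ≡ ∣ length xs - (n ∸ length xs) ∣
    mostar-cut = cong₂ ∣_-_∣ closer-inside closer-outside

  closer-≥1 : ∀ {u v} → u ≢ v → 1 ≤ closer G connected u v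
  closer-≥1 {u} {v} u≢v = count-≥ G (λ w → d w u <? d w v) {u ∷ []} ([] ∷ [])
    λ where (here refl) → subst (_< d u v) (sym (dist-refl u)) (dist-positive u≢v)

  closer-+-≤ : ∀ u v → closer G connected u v + closer G connected v u ≤ n
  closer-+-≤ u v = count-disjoint G (λ w → d w u <? d w v) (λ w → d w v <? d w u) <-asym

  -- Besides `u` itself, `a` is counted: it is adjacent to `u`, and an edge from `a` to `v` would
  -- close a triangle.
  closer-≥2 : Acyclic G → ∀ {u v a} → u ∼ v → u ∼ a → a ≢ v → 2 ≤ closer G connected u v
  closer-≥2 acyclic {u} {v} {a} u∼v u∼a a≢v =
    count-≥ G (λ w → d w u <? d w v) {u ∷ a ∷ []} ((u≢a ∷ []) ∷ [] ∷ []) λ where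
      (here refl)         → subst (_< d u v) (sym (dist-refl u)) (dist-positive u≢v)
      (there (here refl)) → ≤-<-trans (dist-≤ (∼-sym u∼a ∷ [])) far
    where
    u≢a : u ≢ a
    u≢a refl = ∼-irrefl refl u∼a
    u≢v : u ≢ v
    u≢v refl = ∼-irrefl refl u∼v
    far : 1 < d a v
    far with d a v | dist-walk a v
    ... | zero        | []       = contradiction refl a≢v
    ... | suc (suc _) | _        = s≤s (s≤s z≤n)
    ... | suc zero    | a∼v ∷ [] = contradiction (∼-sym a∼v)
      (acyclic (a ∷ u ∷ v ∷ [])
        (∼-sym u∼a ∷ u∼v ∷ [-] , ((u≢a ∘ sym) ∷ a≢v ∷ []) ∷ (u≢v ∷ []) ∷ [] ∷ []))

module _ {n : ℕ} (T : Tree n) (ρ : Fin n) where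
  open Tree T
  open SimpleGraph graph

  private
    h : Fin n → ℕ
    h v = dist graph connected v ρ

    next : ∀ {l v w} → Walk graph l v w → Fin n
    next {v = v} []              = v
    next         (_∷_ {v = v} _ _) = v

    up : Fin n → Fin n
    up v = next (dist-walk graph connected v ρ)

    next-step : ∀ {l v} → v ≢ ρ → (p : Walk graph l v ρ) →
                ∃ λ m → l ≡ suc m × v ∼ next p × Walk graph m (next p) ρ
    next-step v≢ []      = contradiction refl v≢
    next-step v≢ (a ∷ p) = _ , refl , a , p

    next-root : ∀ {l v} (p : Walk graph l v v) → l ≡ 0 → next p ≡ v
    next-root [] _ = refl

    up-adjacent : ∀ {v} → v ≢ ρ → v ∼ up v
    up-adjacent v≢ = proj₁ (proj₂ (proj₂ (next-step v≢ (dist-walk graph connected _ ρ))))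

    h-up : ∀ {v} → v ≢ ρ → h v ≡ suc (h (up v))
    h-up {v} v≢ with next-step v≢ (dist-walk graph connected v ρ)
    ... | m , h≡ , v∼ , p = ≤-antisym
      (dist-≤ graph connected (v∼ ∷ dist-walk graph connected (up v) ρ))
      (subst (suc (h (up v)) ≤_) (sym h≡) (s≤s (dist-≤ graph connected p)))

    -- If the walk visited `x`, the rest of it would reach `ρ` from `x` in fewer than `h x` steps.
    toRoot : ∀ {x u l} → Walk graph l u ρ → l < h x → Star (Avoiding graph x) u ρ
    toRoot []      _   = ε
    toRoot {x} p₀@(a ∷ p) l<h =
      ((λ { refl → <⇒≱ l<h (dist-≤ graph connected p₀) }) , a ,
       (λ { refl → <⇒≱ (<-trans (n<1+n _) l<h) (dist-≤ graph connected p) }))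
      ◅ toRoot p (<-trans (n<1+n _) l<h)

    descent : ∀ {x u} → h u < h x → Star (Avoiding graph x) u ρ
    descent = toRoot (dist-walk graph connected _ ρ)

    avoiding-reverse : ∀ {x u v} → Star (Avoiding graph x) u v → Star (Avoiding graph x) v u
    avoiding-reverse = reverse λ (x≢u , a , x≢v) → x≢v , ∼-sym a , x≢u

    h>0⇒≢ρ : ∀ {v} → 0 < h v → v ≢ ρ
    h>0⇒≢ρ h>0 refl = <⇒≢ h>0 (sym (dist-refl graph connected ρ))

    up-< : ∀ {v} → v ≢ ρ → h (up v) < h v
    up-< v≢ = ≤-reflexive (sym (h-up v≢))

    -- If `v` and `up u` were different neighbours of `u`, descending from both to `ρ` would join
    -- them without meeting `u`, since both are lower than `u`.
    lower-is-up : ∀ {u v} → u ∼ v → h v < h u → u ≢ ρ × up u ≡ v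
    lower-is-up {u} {v} u∼v hv<hu = u≢ , decidable-stable (up u Fin.≟ v) λ up≢ →
      neighbours-separated graph Fin._≟_ acyclic (up-adjacent u≢) u∼v up≢
        (descent (up-< u≢) ◅◅ avoiding-reverse (descent hv<hu))
      where u≢ = h>0⇒≢ρ (≤-<-trans z≤n hv<hu)

    -- The same detour with `up u` and `v` as the two neighbours of `u`. As `v` is not lower than
    -- `u`, its descent starts with the step to `up v`, which avoids `u` because `u` and `v` differ.
    level-not-adjacent : ∀ {u v} → u ∼ v → h u ≢ h v
    level-not-adjacent {u} {v} u∼v hu≡hv =
      neighbours-separated graph Fin._≟_ acyclic (up-adjacent u≢) u∼v
        (λ { refl → <⇒≢ (up-< u≢) (sym hu≡hv) })
        (descent (up-< u≢) ◅◅ avoiding-reverse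
          ((u≢v , up-adjacent v≢ , λ { refl → <⇒≢ (up-< v≢) hu≡hv })
           ◅ descent (subst (h (up v) <_) (sym hu≡hv) (up-< v≢))))
      where
      u≢v : u ≢ v
      u≢v refl = ∼-irrefl refl u∼v
      u≢ : u ≢ ρ
      u≢ refl = <⇒≢ (dist-positive graph connected (u≢v ∘ sym))
                  (trans (sym (dist-refl graph connected ρ)) hu≡hv)
      v≢ : v ≢ ρ
      v≢ = h>0⇒≢ρ (subst (0 <_) hu≡hv (dist-positive graph connected u≢))

  tree⇒rooted : Rooted graph
  tree⇒rooted = record
    { root            = ρ
    ; parent          = up
    ; height          = h
    ; parent-root     = next-root (dist-walk graph connected ρ ρ) (dist-refl graph connected ρ)
    ; parent-adjacent = up-adjacent
    ; height-parent   = h-up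
    ; adjacent⇒parent = orient
    }
    where
    orient : ∀ {u v} → u ∼ v → (u ≢ ρ × up u ≡ v) ⊎ (v ≢ ρ × up v ≡ u)
    orient {u} {v} u∼v with <-cmp (h u) (h v)
    ... | tri< hu<hv _ _ = inj₂ (lower-is-up (∼-sym u∼v) hu<hv)
    ... | tri≈ _ hu≡hv _ = contradiction hu≡hv (level-not-adjacent u∼v)
    ... | tri> _ _ hv<hu = inj₁ (lower-is-up u∼v hv<hu)

module _ {V : Set} (_≟_ : (u v : V) → Dec (u ≡ v)) {G : SimpleGraph V} (R : Rooted G) where
  open SimpleGraph G
  open Rooted R

  private
    walkToRoot : ∀ m v → height v ≤ m → ∃ λ l → Walk G l v root
    walkToRoot m v h≤m with v ≟ root
    ... | yes refl = 0 , []
    walkToRoot zero    v h≤m | no v≢ = contradiction (subst (_≤ 0) (height-parent v≢) h≤m) λ ()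
    walkToRoot (suc m) v h≤m | no v≢ with walkToRoot m (parent v) (s≤s⁻¹ (subst (_≤ suc m) (height-parent v≢) h≤m))
    ... | l , p = suc l , parent-adjacent v≢ ∷ p

  rooted⇒connected : Connected G
  rooted⇒connected u v =
    let _ , p = walkToRoot _ u ≤-refl
        _ , q = walkToRoot _ v ≤-refl
    in _ , walk-++ G p (walk-reverse G q)

  private
    last-∉ : ∀ {m x} (p : Vec V (suc m)) → VecAll.All (x ≢_) p → x ≢ last p
    last-∉ (_ ∷ [])    (x≢ ∷ _)  = x≢
    last-∉ (_ ∷ y ∷ p) (_  ∷ x∉) = last-∉ (y ∷ p) x∉

    ∉-All : ∀ {m x} {p : Vec V m} → VecAll.All (x ≢_) p → ¬ VecAny.Any (x ≡_) p
    ∉-All (x≢ ∷ _)  (here e)   = x≢ e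
    ∉-All (_  ∷ x∉) (there x∈) = ∉-All x∉ x∈

    -- A path that once goes down keeps going down, as its way up is already used.
    down : ∀ {m x} (p : Vec V (suc m)) → IsPath G (x ∷ p) → head p ≢ root → parent (head p) ≡ x →
           height x < height (last p) × VecAny.Any (parent (last p) ≡_) (x ∷ p)
    down (y ∷ []) _ y≢ e = ≤-reflexive (sym (trans (height-parent y≢) (cong (suc ∘ height) e))) , here e
    down (y ∷ p@(z ∷ _)) path@(_ ∷ y∼z ∷ _ , (_ ∷ x≢z ∷ _) ∷ _) y≢ e with adjacent⇒parent y∼z
    ... | inj₁ (_ , e′)  = contradiction (trans (sym e) e′) x≢z
    ... | inj₂ (z≢ , e′) with down p (path-tail G path) z≢ e′
    ...   | lt , any = <-trans (≤-reflexive (sym (trans (height-parent y≢) (cong (suc ∘ height) e)))) lt , there any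

    -- Either every step goes to the parent, and the height falls throughout, or some step goes
    -- down, and `down` applies from there on.
    climb : ∀ {m x} (p : Vec V (suc m)) → IsPath G (x ∷ p) →
            height (last p) < height x ⊎ VecAny.Any (parent (last p) ≡_) (x ∷ p)
    climb {x = x} p@(_ ∷ _) path@(x∼y ∷ _ , _) with adjacent⇒parent x∼y
    ... | inj₂ (y≢ , e) = inj₂ (proj₂ (down p path y≢ e))
    climb (y ∷ [])      path | inj₁ (x≢ , refl) = inj₁ (≤-reflexive (sym (height-parent x≢)))
    climb (y ∷ p@(_ ∷ _)) path | inj₁ (x≢ , refl) with climb p (path-tail G path)
    ... | inj₁ lt  = inj₁ (<-trans lt (≤-reflexive (sym (height-parent x≢))))
    ... | inj₂ any = inj₂ (there any)

  -- If the last vertex of the cycle is the parent of `a`, the path must leave `a` downwards and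
  -- keep descending, yet it ends above `a`. If `a` is the parent of the last vertex, then by
  -- `climb` either `a` occurs a second time, or the last vertex lies strictly above `b`; but it is
  -- one level below `a`, while `b` is at most that low.
  rooted⇒acyclic : Acyclic G
  rooted⇒acyclic (a ∷ q@(b ∷ p@(_ ∷ _))) path@(a∼b ∷ _ , a∉ ∷ b∉ ∷ _) z∼a with adjacent⇒parent z∼a
  ... | inj₂ (a≢ , pa≡z) with adjacent⇒parent a∼b
  ...   | inj₁ (_ , pa≡b)  = contradiction (trans (sym pa≡b) pa≡z) (last-∉ p b∉)
  ...   | inj₂ (b≢ , pb≡a) = <-asym (proj₁ (down q path b≢ pb≡a))
                               (≤-reflexive (sym (trans (height-parent a≢) (cong (suc ∘ height) pa≡z))))
  rooted⇒acyclic (a ∷ q@(b ∷ p@(_ ∷ _))) path@(a∼b ∷ _ , a∉ ∷ b∉ ∷ _) z∼a | inj₁ (z≢ , pz≡a)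
    with climb p (path-tail G path)
  ... | inj₂ any = ∉-All a∉ (subst (λ c → VecAny.Any (c ≡_) q) pz≡a any)
  ... | inj₁ hz<hb with adjacent⇒parent a∼b
  ...   | inj₁ (a≢ , pa≡b) = <-asym hz<hb (<-trans
            (≤-reflexive (sym (trans (height-parent a≢) (cong (suc ∘ height) pa≡b))))
            (≤-reflexive (sym (trans (height-parent z≢) (cong (suc ∘ height) pz≡a)))))
  ...   | inj₂ (b≢ , pb≡a) = <⇒≢ hz<hb (trans (height-parent z≢)
            (trans (cong (suc ∘ height) (trans pz≡a (sym pb≡a))) (sym (height-parent b≢))))

-- The Mostar index as a sum over labelled vertices

module _ {A B : Set} where

  length-cartesianProduct : (xs : List A) (ys : List B) →
                            length (cartesianProduct xs ys) ≡ length xs * length ys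
  length-cartesianProduct []       ys = refl
  length-cartesianProduct (x ∷ xs) ys = trans (length-++ (map (x ,_) ys))
    (cong₂ _+_ (length-map (x ,_) ys) (length-cartesianProduct xs ys))

module _ {A : Set} where

  length-map-grid : ∀ {k r} (f : Fin k × Fin r → A) → length (map f (cartesianProduct (allFin k) (allFin r))) ≡ k * r
  length-map-grid {k} {r} f = begin
    length (map f (cartesianProduct (allFin k) (allFin r)))   ≡⟨ length-map f (cartesianProduct (allFin k) (allFin r)) ⟩
    length (cartesianProduct (allFin k) (allFin r))           ≡⟨ length-cartesianProduct (allFin k) (allFin r) ⟩
    length (allFin k) * length (allFin r)                     ≡⟨ cong₂ _*_ (length-tabulate {n = k} id) (length-tabulate {n = r} id) ⟩
    k * r                                                     ∎
    where open ≡-Reasoning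

  unique-complete⇒↔ : ∀ {n} {xs : List A} → Unique xs → (∀ x → x ∈ xs) → length xs ≡ n → A ↔ Fin n
  unique-complete⇒↔ {xs = xs} xs! complete refl = mk↔ₛ′ (index ∘ complete) (List.lookup xs)
    (λ i → list-lookup-injective xs! (sym (lookup-index (complete (List.lookup xs i)))))
    (λ x → sym (lookup-index (complete x)))

  sum-mono-≤ : ∀ {f g : A → ℕ} xs → (∀ {x} → x ∈ xs → f x ≤ g x) → sum (map f xs) ≤ sum (map g xs)
  sum-mono-≤ []       _   = z≤n
  sum-mono-≤ (x ∷ xs) f≤g = +-mono-≤ (f≤g (here refl)) (sum-mono-≤ xs (f≤g ∘ there))

  -- Termwise inequality together with the reverse inequality of the sums leaves no slack in any
  -- term.
  sum-squeeze : ∀ {f g : A → ℕ} xs → (∀ {x} → x ∈ xs → f x ≤ g x) → sum (map g xs) ≤ sum (map f xs) →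
                ∀ {x} → x ∈ xs → g x ≤ f x
  sum-squeeze {f} {g} (x ∷ xs) f≤g Σg≤Σf (here refl) = +-cancelʳ-≤ (sum (map f xs)) (g x) (f x)
    (≤-trans (+-monoʳ-≤ (g x) (sum-mono-≤ xs (f≤g ∘ there))) Σg≤Σf)
  sum-squeeze {f} {g} (x ∷ xs) f≤g Σg≤Σf (there x∈) = sum-squeeze xs (f≤g ∘ there)
    (+-cancelˡ-≤ (f x) _ _ (≤-trans (+-monoˡ-≤ (sum (map g xs)) (f≤g (here refl))) Σg≤Σf)) x∈

module _ {n : ℕ} where

  ordered : Fin n → Fin n → Fin n × Fin n
  ordered u v with u Fin.<? v
  ... | yes _ = u , v
  ... | no  _ = v , u

  ordered-< : ∀ {u v} → u Fin.< v → ordered u v ≡ (u , v)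
  ordered-< {u} {v} u<v with u Fin.<? v
  ... | yes _  = refl
  ... | no u≮v = contradiction u<v u≮v

  ordered-> : ∀ {u v} → u Fin.< v → ordered v u ≡ (u , v)
  ordered-> {u} {v} u<v with v Fin.<? u
  ... | yes v<u = contradiction v<u (<-asym u<v)
  ... | no _    = refl

  ordered-cases : ∀ u v → ordered u v ≡ (u , v) ⊎ ordered u v ≡ (v , u)
  ordered-cases u v with u Fin.<? v
  ... | yes _ = inj₁ refl
  ... | no  _ = inj₂ refl

  module _ {G : SimpleGraph (Fin n)} (R : Rooted G) where
    open SimpleGraph G
    open Rooted R

    private
      edge : Fin n → Fin n × Fin n
      edge v = ordered v (parent v)

      crossed : ∀ {u v} → (u , parent u) ≡ (parent v , v) → u ≡ v
      crossed {u} {v} e with v Fin.≟ root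
      ... | yes refl = trans (cong proj₁ e) parent-root
      ... | no  v≢   = contradiction (trans (cong parent (sym (cong proj₁ e))) (cong proj₂ e)) (grandparent-≢ v≢)

      edge-injective : ∀ {u v} → edge u ≡ edge v → u ≡ v
      edge-injective {u} {v} e with ordered-cases u (parent u) | ordered-cases v (parent v)
      ... | inj₁ p | inj₁ q = cong proj₁ (trans (sym p) (trans e q))
      ... | inj₂ p | inj₂ q = cong proj₂ (trans (sym p) (trans e q))
      ... | inj₁ p | inj₂ q = crossed (trans (sym p) (trans e q))
      ... | inj₂ p | inj₁ q = sym (crossed (trans (sym q) (trans (sym e) p)))

      edge? : U.Decidable (uncurry λ u v → u Fin.< v × u ∼ v)
      edge? = uncurry λ u v → (u Fin.<? v) ×-dec (u ∼? v)
        where open import Relation.Nullary.Decidable using (_×-dec_)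

    -- Both lists are duplicate-free and have the same members. On the right this rests on
    -- `edge-injective`: an edge determines its lower end.
    edges-↭ : ∀ {xs} → Unique xs → root ∉ xs → (∀ {v} → v ≢ root → v ∈ xs) →
              edges G ↭ map edge xs
    edges-↭ {xs} xs! root∉ complete = ∼bag⇒↭ (unique∧set⇒bag
      (Unique.filter⁺ edge? (Unique.cartesianProduct⁺ (Unique.allFin⁺ n) (Unique.allFin⁺ n)))
      (Unique.map⁺ edge-injective xs!)
      (mk⇔ to from))
      where
      to : ∀ {e} → e ∈ edges G → e ∈ map edge xs
      to {u , v} e∈ with ∈-filter⁻ edge? {xs = cartesianProduct (allFin n) (allFin n)} e∈
      ... | _ , u<v , u∼v with adjacent⇒parent u∼v
      ...   | inj₁ (u≢ , refl) = subst (_∈ map edge xs) (ordered-< u<v) (∈-map⁺ edge (complete u≢))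
      ...   | inj₂ (v≢ , refl) = subst (_∈ map edge xs) (ordered-> u<v) (∈-map⁺ edge (complete v≢))

      listed : ∀ {u v} → u Fin.< v → u ∼ v → (u , v) ∈ edges G
      listed u<v u∼v = ∈-filter⁺ edge? (∈-cartesianProduct⁺ (∈-allFin _) (∈-allFin _)) (u<v , u∼v)

      from : ∀ {e} → e ∈ map edge xs → e ∈ edges G
      from e∈ with ∈-map⁻ edge e∈
      ... | v , v∈ , refl with Fin.<-cmp v (parent v) | parent-adjacent {v} (λ { refl → root∉ v∈ })
      ...   | tri< v<p _ _ | a = subst (_∈ edges G) (sym (ordered-< v<p)) (listed v<p a)
      ...   | tri> _ _ p<v | a = subst (_∈ edges G) (sym (ordered-> p<v)) (listed p<v (∼-sym a))
      ...   | tri≈ _ v≡p _ | a = contradiction a (∼-irrefl v≡p)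

    sum-over-edges : ∀ {xs} → Unique xs → root ∉ xs → (∀ {v} → v ≢ root → v ∈ xs) →
                     (f : Fin n → Fin n → ℕ) → (∀ u v → f u v ≡ f v u) →
                     sum (map (uncurry f) (edges G)) ≡ sum (map (λ v → f v (parent v)) xs)
    sum-over-edges {xs} xs! root∉ complete f f-comm = trans
      (sum-↭ (Perm.map⁺ (uncurry f) (edges-↭ xs! root∉ complete)))
      (cong sum (trans (sym (map-∘ xs)) (map-cong unordered xs)))
      where
      unordered : ∀ v → uncurry f (edge v) ≡ f v (parent v)
      unordered v with v Fin.<? parent v
      ... | yes _ = refl
      ... | no  _ = f-comm (parent v) v

-- Labellings of the vertices by `SVertex n k r`

module _ {n k r : ℕ} where

  arm-injective : ∀ {j j′ i i′} → arm {n} {k} {r} j i ≡ arm j′ i′ → j ≡ j′ × i ≡ i′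
  arm-injective refl = refl , refl

  leaf-injective : ∀ {l l′} → leaf {n} {k} {r} l ≡ leaf l′ → l ≡ l′
  leaf-injective refl = refl

  arms leaves nonCentre : List (SVertex n k r)
  arms      = map (uncurry arm) (cartesianProduct (allFin k) (allFin r))
  leaves    = map leaf (allFin (n ∸ k * r ∸ 1))
  nonCentre = arms ++ leaves

  arm∈ : ∀ j i → arm j i ∈ nonCentre
  arm∈ j i = ∈-++⁺ˡ (∈-map⁺ (uncurry arm) (∈-cartesianProduct⁺ (∈-allFin j) (∈-allFin i)))

  leaf∈ : ∀ l → leaf l ∈ nonCentre
  leaf∈ l = ∈-++⁺ʳ arms (∈-map⁺ leaf (∈-allFin l))

  arms⁻ : ∀ {x} → x ∈ arms → ∃ λ p → x ≡ uncurry arm p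
  arms⁻ x∈ = let p , _ , x≡ = ∈-map⁻ (uncurry arm) x∈ in p , x≡

  leaves⁻ : ∀ {x} → x ∈ leaves → ∃ λ l → x ≡ leaf l
  leaves⁻ x∈ = let l , _ , x≡ = ∈-map⁻ leaf x∈ in l , x≡

  centre∉ : centre ∉ nonCentre
  centre∉ c∈ with ∈-++⁻ arms c∈
  ... | inj₁ c∈arms   with () ← proj₂ (arms⁻ c∈arms)
  ... | inj₂ c∈leaves with () ← proj₂ (leaves⁻ c∈leaves)

  leaves! : Unique leaves
  leaves! = Unique.map⁺ leaf-injective (Unique.allFin⁺ (n ∸ k * r ∸ 1))

  nonCentre! : Unique nonCentre
  nonCentre! = Unique.++⁺
    (Unique.map⁺ (λ { {_ , _} {_ , _} refl → refl }) (Unique.cartesianProduct⁺ (Unique.allFin⁺ k) (Unique.allFin⁺ r)))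
    leaves!
    λ (x∈a , x∈l) → contradiction (trans (sym (proj₂ (arms⁻ x∈a))) (proj₂ (leaves⁻ x∈l))) λ ()

  length-leaves : length leaves ≡ n ∸ k * r ∸ 1
  length-leaves = trans (length-map (leaf {n} {k} {r}) (allFin (n ∸ k * r ∸ 1))) (length-tabulate {n = n ∸ k * r ∸ 1} id)

  SVertex↔Fin : k * r + 1 ≤ n → SVertex n k r ↔ Fin n
  SVertex↔Fin kr<n = unique-complete⇒↔
    (All.tabulate (λ {x} x∈ c≡x → centre∉ (subst (_∈ nonCentre) (sym c≡x) x∈)) ∷ nonCentre!)
    (λ where
      centre    → here refl
      (arm j i) → there (arm∈ j i)
      (leaf l)  → there (leaf∈ l))
    size
    where
    size : suc (length nonCentre) ≡ n
    size = begin
      suc (length nonCentre)                 ≡⟨ cong suc (length-++ arms) ⟩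
      suc (length arms + length leaves)      ≡⟨ cong suc (cong₂ _+_ (length-map-grid (uncurry (arm {n} {k} {r}))) length-leaves) ⟩
      suc (k * r + (n ∸ k * r ∸ 1))          ≡⟨ cong (λ m → suc (k * r + m)) (∸-+-assoc n (k * r) 1) ⟩
      suc (k * r) + (n ∸ (k * r + 1))        ≡⟨ cong (_+ (n ∸ (k * r + 1))) (+-comm 1 (k * r)) ⟩
      k * r + 1 + (n ∸ (k * r + 1))          ≡⟨ m+[n∸m]≡n kr<n ⟩
      n                                      ∎
      where open ≡-Reasoning

  -- The vertices off the root and the arms receive the leaf labels in the order of `allFin n`;
  -- counting the complement shows that there are as many of them as labels. They need not be leaves
  -- of the graph.
  extend-arms : (ρ : Fin n) (a : Fin k → Fin r → Fin n) →
                (∀ {j i j′ i′} → a j i ≡ a j′ i′ → j ≡ j′ × i ≡ i′) → (∀ j i → a j i ≢ ρ) →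
                (G : SimpleGraph (Fin n)) →
                Σ (SVertex n k r ↔ Fin n) λ φ →
                  Inverse.to φ centre ≡ ρ × (∀ j i → Inverse.to φ (arm j i) ≡ a j i)
  extend-arms ρ a a-injective a≢ρ G =
    ⤖⇒↔ (mk⤖ (to-injective , strictlySurjective⇒surjective to-surjective)) , refl , λ _ _ → refl
    where
    spine : List (Fin n)
    spine = ρ ∷ map (uncurry a) (cartesianProduct (allFin k) (allFin r))

    spine? : U.Decidable (_∈ spine)
    spine? v = Any.any? (v Fin.≟_) spine

    a∈spine : ∀ j i → a j i ∈ spine
    a∈spine j i = there (∈-map⁺ (uncurry a) (∈-cartesianProduct⁺ (∈-allFin j) (∈-allFin i)))

    spine! : Unique spine
    spine! = All.tabulate (λ x∈ ρ≡x → off (∈-map⁻ (uncurry a) x∈) ρ≡x)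
           ∷ Unique.map⁺ (λ {p} {q} e → cong₂ _,_ (proj₁ (a-injective e)) (proj₂ (a-injective e)))
               (Unique.cartesianProduct⁺ (Unique.allFin⁺ k) (Unique.allFin⁺ r))
      where
      off : ∀ {x ps} → (∃ λ p → p ∈ ps × x ≡ uncurry a p) → ρ ≢ x
      off ((j , i) , _ , x≡) ρ≡x = a≢ρ j i (sym (trans ρ≡x x≡))

    rest : List (Fin n)
    rest = filter (¬? ∘ spine?) (allFin n)

    rest! : Unique rest
    rest! = Unique.filter⁺ (¬? ∘ spine?) (Unique.allFin⁺ n)

    length-rest : n ∸ k * r ∸ 1 ≡ length rest
    length-rest = begin
      n ∸ k * r ∸ 1                                                  ≡⟨ ∸-+-assoc n (k * r) 1 ⟩
      n ∸ (k * r + 1)                                                ≡⟨ cong (n ∸_) (+-comm (k * r) 1) ⟩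
      n ∸ suc (k * r)                                                ≡⟨ cong₂ _∸_ (sym total) (sym length-spine) ⟩
      (count G spine? + count G (¬? ∘ spine?)) ∸ count G spine?      ≡⟨ m+n∸m≡n (count G spine?) _ ⟩
      length rest                                                    ∎
      where
      open ≡-Reasoning
      total : count G spine? + count G (¬? ∘ spine?) ≡ n
      total = count-complement G spine? (¬? ∘ spine?) (λ x∈ x∉ → x∉ x∈) (λ _ x∉ → x∉)
      length-spine : count G spine? ≡ suc (k * r)
      length-spine = trans (count-≡ G spine? spine! id id) (cong suc (length-map-grid (uncurry a)))

    to : SVertex n k r → Fin n
    to centre    = ρ
    to (arm j i) = a j i
    to (leaf l)  = List.lookup rest (Fin.cast length-rest l)

    leaf-off : ∀ l → to (leaf l) ∉ spine
    leaf-off l = proj₂ (∈-filter⁻ (¬? ∘ spine?) {xs = allFin n} (∈-lookup (Fin.cast length-rest l)))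

    to-injective : Injective _≡_ _≡_ to
    to-injective {centre}  {centre}    _ = refl
    to-injective {centre}  {arm j i}   e = contradiction (sym e) (a≢ρ j i)
    to-injective {centre}  {leaf l}    e = contradiction (here (sym e)) (leaf-off l)
    to-injective {arm j i} {centre}    e = contradiction e (a≢ρ j i)
    to-injective {arm j i} {arm _ _}   e with refl , refl ← a-injective e = refl
    to-injective {arm j i} {leaf l}    e = contradiction (subst (_∈ spine) e (a∈spine j i)) (leaf-off l)
    to-injective {leaf l}  {centre}    e = contradiction (here e) (leaf-off l)
    to-injective {leaf l}  {arm j i}   e = contradiction (subst (_∈ spine) (sym e) (a∈spine j i)) (leaf-off l)
    to-injective {leaf l}  {leaf l′}   e = cong leaf (Fin.toℕ-injective (trans (sym (Fin.toℕ-cast length-rest l))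
      (trans (cong toℕ (list-lookup-injective rest! e)) (Fin.toℕ-cast length-rest l′))))

    to-surjective : ∀ v → ∃ λ x → to x ≡ v
    to-surjective v with spine? v
    ... | yes (here v≡ρ) = centre , sym v≡ρ
    ... | yes (there v∈) with ∈-map⁻ (uncurry a) v∈
    ...   | (j , i) , _ , v≡ = arm j i , sym v≡
    to-surjective v | no v∉ = leaf (Fin.cast (sym length-rest) (index v∈)) ,
      trans (cong (List.lookup rest) (Fin.cast-involutive length-rest (sym length-rest) (index v∈))) (sym (lookup-index v∈))
      where
      v∈ : v ∈ rest
      v∈ = ∈-filter⁺ (¬? ∘ spine?) (∈-allFin v) v∉

-- The common ground of an arbitrary tree and the star. Arms are numbered outwards from the root
-- side and do not branch; the parents of their first vertices and of the leaf-labelled vertices are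
-- left open.
record ArmSystem {n : ℕ} (k r : ℕ) {G : SimpleGraph (Fin n)} (R : Rooted G) : Set where
  open Rooted R
  field
    labelling : SVertex n k r ↔ Fin n
  open Inverse labelling public using () renaming (to to at; from to label)
  field
    at-centre  : at centre ≡ root
    arm-parent : ∀ {j i i′} → toℕ i′ ≡ suc (toℕ i) → parent (at (arm j i′)) ≡ at (arm j i)
    arm-child  : ∀ {v j i} → v ≢ root → parent v ≡ at (arm j i) →
                 ∃ λ i′ → toℕ i′ ≡ suc (toℕ i) × v ≡ at (arm j i′)

  at-injective : ∀ {x y} → at x ≡ at y → x ≡ y
  at-injective {x} {y} e = trans (sym (Inverse.strictlyInverseʳ labelling x))
    (trans (cong label e) (Inverse.strictlyInverseʳ labelling y))

  at-label : ∀ v → at (label v) ≡ v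
  at-label = Inverse.strictlyInverseˡ labelling

  at≢root : ∀ {x} → x ≢ centre → at x ≢ root
  at≢root x≢ e = x≢ (at-injective (trans e (sym at-centre)))

module _ {n : ℕ} (G : SimpleGraph (Fin n)) (connected : Connected G) where

  imbalance : Fin n → Fin n → ℕ
  imbalance u v = ∣ closer G connected u v - closer G connected v u ∣

  module _ {k r : ℕ} {R : Rooted G} (A : ArmSystem k r R) where
    open SimpleGraph G
    open Rooted R
    open ArmSystem A

    parent-imbalance : SVertex n k r → ℕ
    parent-imbalance x = imbalance (at x) (parent (at x))

    mostar-labelled : mostar G connected ≡ sum (map parent-imbalance nonCentre)
    mostar-labelled = trans
      (sum-over-edges R (Unique.map⁺ at-injective nonCentre!) root∉ complete imbalance
        (λ u v → ∣-∣-comm (closer G connected u v) (closer G connected v u)))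
      (cong sum (sym (map-∘ {g = λ v → imbalance v (parent v)} {f = at} nonCentre)))
      where
      root∉ : root ∉ map at nonCentre
      root∉ r∈ with ∈-map⁻ at r∈
      ... | x , x∈ , root≡ = centre∉ (subst (_∈ nonCentre) (at-injective (trans (sym root≡) (sym at-centre))) x∈)

      listed : ∀ x → at x ≢ root → at x ∈ map at nonCentre
      listed centre    ≢ = contradiction at-centre ≢
      listed (arm j i) _ = ∈-map⁺ at (arm∈ j i)
      listed (leaf l)  _ = ∈-map⁺ at (leaf∈ l)

      complete : ∀ {v} → v ≢ root → v ∈ map at nonCentre
      complete {v} v≢ = subst (_∈ map at nonCentre) (at-label v)
        (listed (label v) (v≢ ∘ trans (sym (at-label v))))

    -- Arms do not branch, so the edge above `arm j i` cuts off just the part of the arm from `i`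
    -- outwards. The size of this part stays in the form of a list length, because it only has to
    -- agree between two trees.
    arm-imbalance : ∀ j i → let s = length (filter (i Fin.≤?_) (allFin r)) in
                    parent-imbalance (arm j i) ≡ ∣ s - (n ∸ s) ∣
    arm-imbalance j i = trans
      (mostar-cut G connected (Unique.map⁺ (proj₂ ∘ arm-injective ∘ at-injective) (Unique.filter⁺ (i Fin.≤?_) (Unique.allFin⁺ r)))
        (outer Fin.≤-refl) parent∉ cut)
      (cong (λ s → ∣ s - (n ∸ s) ∣) (length-map (at ∘ arm j) (filter (i Fin.≤?_) (allFin r))))
      where
      branch : List (Fin n)
      branch = map (at ∘ arm j) (filter (i Fin.≤?_) (allFin r))

      outer : ∀ {i′} → i Fin.≤ i′ → at (arm j i′) ∈ branch
      outer i≤i′ = ∈-map⁺ (at ∘ arm j) (∈-filter⁺ (i Fin.≤?_) (∈-allFin _) i≤i′)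

      branch⁻ : ∀ {x} → x ∈ branch → ∃ λ i′ → i Fin.≤ i′ × x ≡ at (arm j i′)
      branch⁻ x∈ with ∈-map⁻ (at ∘ arm j) x∈
      ... | i′ , i′∈ , x≡ = i′ , proj₂ (∈-filter⁻ (i Fin.≤?_) {xs = allFin r} i′∈) , x≡

      parent∉ : parent (at (arm j i)) ∉ branch
      parent∉ p∈ with branch⁻ p∈
      ... | i₁ , i≤i₁ , p≡ with arm-child (at≢root λ ()) p≡
      ...   | i₂ , i₂≡ , e with refl ← at-injective e = <⇒≱ (≤-reflexive (sym i₂≡)) i≤i₁

      cut : ∀ {x y} → x ∼ y → x ∈ branch → y ∉ branch → x ≡ at (arm j i) × y ≡ parent (at (arm j i))
      cut {x} {y} x∼y x∈ y∉ with branch⁻ x∈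
      ... | i₁ , i≤i₁ , refl with adjacent⇒parent x∼y
      ...   | inj₂ (y≢ , py≡x) with arm-child y≢ py≡x
      ...     | i₂ , i₂≡ , refl = contradiction (outer (≤-trans i≤i₁ (≤-trans (n≤1+n _) (≤-reflexive (sym i₂≡))))) y∉
      cut {x} {y} x∼y x∈ y∉ | i₁ , i≤i₁ , refl | inj₁ (_ , refl) with i Fin.≟ i₁
      ... | yes refl = refl , refl
      ... | no i≢i₁ with predecessor i₁ (Fin.≤∧≢⇒< i≤i₁ i≢i₁)
        where
        predecessor : ∀ {m} {i : Fin m} (i₁ : Fin m) → i Fin.< i₁ →
                      ∃ λ (i₀ : Fin m) → i Fin.≤ i₀ × toℕ i₁ ≡ suc (toℕ i₀)
        predecessor {i = i} (suc i₁) i<i₁ =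
          Fin.inject₁ i₁ , subst (toℕ i ≤_) (sym (Fin.toℕ-inject₁ i₁)) (s≤s⁻¹ i<i₁) ,
          cong suc (sym (Fin.toℕ-inject₁ i₁))
      ...   | i₀ , i≤i₀ , i₁≡ = contradiction (subst (_∈ branch) (sym (arm-parent i₁≡)) (outer i≤i₀)) y∉

-- Pendent paths

module _ {A : Set} where

  linked-lookup : ∀ {R : A → A → Set} {m} {xs : Vec A m} → Linked R xs →
                  ∀ {s t} → toℕ t ≡ suc (toℕ s) → R (lookup xs s) (lookup xs t)
  linked-lookup {xs = _ ∷ _ ∷ _} (x∼y ∷ _)    {zero}  {suc zero} _ = x∼y
  linked-lookup                  (_ ∷ linked) {suc s} {suc t}    e = linked-lookup linked (suc-injective e)

  lookup-last : ∀ {m} (xs : Vec A (suc m)) → lookup xs (Fin.fromℕ m) ≡ last xs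
  lookup-last (x ∷ [])     = refl
  lookup-last (_ ∷ y ∷ xs) = lookup-last (y ∷ xs)

  lookup-extensional : ∀ {m} {xs ys : Vec A m} → (∀ i → lookup xs i ≡ lookup ys i) → xs ≡ ys
  lookup-extensional {xs = xs} {ys} eq = trans (sym (tabulate∘lookup xs)) (trans (tabulate-cong eq) (tabulate∘lookup ys))

module _ {n r : ℕ} {G : SimpleGraph (Fin n)} {w : Vec (Fin n) (suc r)} (pendent : IsPendentPath G {r} w) where
  open SimpleGraph G
  open IsPendentPath pendent

  pendent-step : ∀ {s t} → toℕ t ≡ suc (toℕ s) → lookup w s ∼ lookup w t
  pendent-step = linked-lookup (proj₁ isPath)

  pendent-start : degree G (lookup w zero) ≡ 1
  pendent-start = trans (cong (degree G) (head-lookup w)) start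
    where
    head-lookup : ∀ {m} (xs : Vec (Fin n) (suc m)) → lookup xs zero ≡ head xs
    head-lookup (_ ∷ _) = refl

  -- The degree, one at the start and two further on, is exhausted by the neighbours along the path.
  pendent-neighbour : ∀ {s y} → toℕ s < r → lookup w s ∼ y →
                      ∃ λ t → (toℕ t ≡ suc (toℕ s) ⊎ suc (toℕ t) ≡ toℕ s) × y ≡ lookup w t
  pendent-neighbour {zero} {y} (s≤s _) a
    with count-saturated G (lookup w zero ∼?_) {lookup w (suc zero) ∷ []} ([] ∷ [])
           (λ { (here refl) → pendent-step refl })
           (≤-reflexive pendent-start) a
  ... | here y≡ = suc zero , inj₁ refl , y≡
  pendent-neighbour {suc s} {y} s<r a
    with count-saturated G (lookup w (suc s) ∼?_) {lookup w t ∷ lookup w (Fin.inject₁ s) ∷ []}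
           ((distinct ∷ []) ∷ [] ∷ [])
           (λ { (here refl) → pendent-step t≡ ; (there (here refl)) → ∼-sym (pendent-step s≡) })
           (≤-reflexive (internal (suc s) (s≤s z≤n) s<r)) a
    where
    t = Fin.fromℕ< (s≤s s<r)
    t≡ : toℕ t ≡ suc (suc (toℕ s))
    t≡ = Fin.toℕ-fromℕ< (s≤s s<r)
    s≡ : suc (toℕ s) ≡ suc (toℕ (Fin.inject₁ s))
    s≡ = cong suc (sym (Fin.toℕ-inject₁ s))
    distinct : lookup w t ≢ lookup w (Fin.inject₁ s)
    distinct e = m≢1+n+m (toℕ s) (trans (trans (sym (Fin.toℕ-inject₁ s))
      (cong toℕ (sym (VecUnique.lookup-injective (proj₂ isPath) t (Fin.inject₁ s) e)))) t≡)
  ... | here y≡         = _ , inj₁ (Fin.toℕ-fromℕ< (s≤s s<r)) , y≡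
  ... | there (here y≡) = _ , inj₂ (cong suc (Fin.toℕ-inject₁ s)) , y≡

  module _ (R : Rooted G) (avoids-root : ∀ s → toℕ s < r → lookup w s ≢ Rooted.root R) where
    open Rooted R

    private
      -- The start has its successor as only neighbour. A later vertex has two, but its predecessor
      -- is not its parent, being its child by induction.
      ascend-at : ∀ m {s t} → toℕ s ≡ m → toℕ s < r → toℕ t ≡ suc (toℕ s) → parent (lookup w s) ≡ lookup w t
      ascend-at m {s} {t} s≡m s<r t≡ with pendent-neighbour s<r (parent-adjacent (avoids-root s s<r))
      ... | t′ , inj₁ t′≡ , e = trans e (cong (lookup w) (Fin.toℕ-injective (trans t′≡ (sym t≡))))
      ... | s′ , inj₂ s≡  , e with m
      ...   | zero  with () ← trans s≡ s≡m
      ...   | suc m = contradiction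
                (trans (cong parent (ascend-at m (suc-injective (trans s≡ s≡m)) s′<r (sym s≡))) e)
                (grandparent-≢ (avoids-root s′ s′<r))
        where
        s′<r : toℕ s′ < r
        s′<r = ≤-trans (≤-trans (≤-reflexive s≡) (n≤1+n _)) s<r

    ascend : ∀ {s t} → toℕ s < r → toℕ t ≡ suc (toℕ s) → parent (lookup w s) ≡ lookup w t
    ascend = ascend-at _ refl

    descend : ∀ {s v} → toℕ s < r → v ≢ root → parent v ≡ lookup w s →
              ∃ λ t → suc (toℕ t) ≡ toℕ s × v ≡ lookup w t
    descend {s} {v} s<r v≢ pv≡ with pendent-neighbour s<r (∼-sym (subst (v ∼_) pv≡ (parent-adjacent v≢)))
    ... | t , inj₂ t≡ , v≡ = t , t≡ , v≡
    ... | t , inj₁ t≡ , v≡ = contradiction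
      (trans (cong parent (trans (ascend s<r t≡) (sym v≡))) pv≡)
      (grandparent-≢ (avoids-root s s<r))

module _ {n r : ℕ} {G : SimpleGraph (Fin n)} (R : Rooted G) {w w′ : Vec (Fin n) (suc r)}
         (pendent : IsPendentPath G {r} w) (pendent′ : IsPendentPath G {r} w′)
         (avoids  : ∀ s → toℕ s < r → lookup w s ≢ Rooted.root R)
         (avoids′ : ∀ s → toℕ s < r → lookup w′ s ≢ Rooted.root R) where
  open Rooted R

  -- Follow both paths down from the common vertex: the predecessor on `w` is a child of that
  -- vertex, hence also the predecessor on `w′`. The paths reach their starts together, since a
  -- start has degree one and an interior vertex degree two.
  pendent-meet-same-index : ∀ {s t} → toℕ s < r → toℕ t < r → lookup w s ≡ lookup w′ t →
                            s ≡ t × lookup w zero ≡ lookup w′ zero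
  pendent-meet-same-index = go _ refl
    where
    go : ∀ m {s t} → toℕ s ≡ m → toℕ s < r → toℕ t < r → lookup w s ≡ lookup w′ t →
         s ≡ t × lookup w zero ≡ lookup w′ zero
    go m {zero}  {zero}  _ _ _ e = refl , e
    go m {zero}  {suc t} _ _ t<r e
      with () ← trans (sym (pendent-start pendent)) (trans (cong (degree G) e)
                  (IsPendentPath.internal pendent′ (suc t) (s≤s z≤n) t<r))
    go (suc m) {suc s} {t} s≡m s<r t<r e
      with descend pendent′ R avoids′ t<r (avoids (Fin.inject₁ s) s′<r)
             (trans (ascend pendent R avoids s′<r (cong suc (sym (Fin.toℕ-inject₁ s)))) e)
      where
      s′<r : toℕ (Fin.inject₁ s) < r
      s′<r = subst (_< r) (sym (Fin.toℕ-inject₁ s)) (<-trans (n<1+n _) s<r)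
    ... | t′ , t≡ , e′
      with go m {Fin.inject₁ s} {t′} (trans (Fin.toℕ-inject₁ s) (suc-injective s≡m))
             (subst (_< r) (sym (Fin.toℕ-inject₁ s)) (<-trans (n<1+n _) s<r))
             (≤-trans (≤-trans (≤-reflexive t≡) (n≤1+n _)) t<r) e′
    ...   | s≡t′ , e₀ = Fin.toℕ-injective (trans (cong suc (trans (sym (Fin.toℕ-inject₁ s)) (cong toℕ s≡t′))) t≡) , e₀

  pendent-determined-by-start : lookup w zero ≡ lookup w′ zero → w ≡ w′
  pendent-determined-by-start e₀ = lookup-extensional λ s → go _ refl
    where
    go : ∀ m {s} → toℕ s ≡ m → lookup w s ≡ lookup w′ s
    go zero    {zero}  _ = e₀
    go (suc m) {suc s} e = begin
      lookup w (suc s)                     ≡⟨ ascend pendent R avoids s<r s≡ ⟨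
      parent (lookup w (Fin.inject₁ s))    ≡⟨ cong parent (go m (trans (Fin.toℕ-inject₁ s) (suc-injective e))) ⟩
      parent (lookup w′ (Fin.inject₁ s))   ≡⟨ ascend pendent′ R avoids′ s<r s≡ ⟩
      lookup w′ (suc s)                    ∎
      where
      open ≡-Reasoning
      s≡ : suc (toℕ s) ≡ suc (toℕ (Fin.inject₁ s))
      s≡ = cong suc (sym (Fin.toℕ-inject₁ s))
      s<r : toℕ (Fin.inject₁ s) < r
      s<r = subst (_< r) (sym (Fin.toℕ-inject₁ s)) (Fin.toℕ<n s)

-- In opposite s the index of a pendent path becomes the distance from its end.
opposite-step : ∀ {m} {s t : Fin (suc m)} → toℕ t ≡ suc (toℕ s) → toℕ (Fin.opposite s) ≡ suc (toℕ (Fin.opposite t))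
opposite-step {m} {s} {t} e = begin
  toℕ (Fin.opposite s)         ≡⟨ Fin.opposite-prop s ⟩
  m ∸ toℕ s                    ≡⟨ lemma (subst (_≤ m) e (s≤s⁻¹ (Fin.toℕ<n t))) ⟩
  suc (m ∸ suc (toℕ s))        ≡⟨ cong (λ i → suc (m ∸ i)) e ⟨
  suc (m ∸ toℕ t)              ≡⟨ cong suc (Fin.opposite-prop t) ⟨
  suc (toℕ (Fin.opposite t))   ∎
  where
  open ≡-Reasoning
  lemma : ∀ {i m} → suc i ≤ m → m ∸ i ≡ suc (m ∸ suc i)
  lemma (s≤s i≤m) = +-∸-assoc 1 i≤m

opposite-suc-< : ∀ {m} (i : Fin m) → toℕ (Fin.opposite (suc i)) < m
opposite-suc-< {m} i = subst (_< m) (sym (Fin.opposite-suc i)) (Fin.toℕ<n (Fin.opposite i))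

opposite-injective : ∀ {m} {i j : Fin m} → Fin.opposite i ≡ Fin.opposite j → i ≡ j
opposite-injective {i = i} {j} e = trans (sym (Fin.opposite-involutive i)) (trans (cong Fin.opposite e) (Fin.opposite-involutive j))

module _ {n k r : ℕ} {G : SimpleGraph (Fin n)} (R : Rooted G)
         (paths : Exactly k (IsPendentPath G {r}))
         (avoids-root : ∀ j s → toℕ s < r → lookup (Exactly.enum paths j) s ≢ Rooted.root R) where
  open Rooted R
  open Exactly paths

  private
    pendent : ∀ j → IsPendentPath G {r} (enum j)
    pendent j = Equivalence.from (enum-image (enum j)) (j , refl)

    -- With `suc` the distance zero is left out: the end of a pendent path does not belong to the
    -- arm, as several paths may share it.
    a : Fin k → Fin r → Fin n
    a j i = lookup (enum j) (Fin.opposite (suc i))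

    a-injective : ∀ {j i j′ i′} → a j i ≡ a j′ i′ → j ≡ j′ × i ≡ i′
    a-injective {j} {i} {j′} {i′} e
      with pendent-meet-same-index R (pendent j) (pendent j′) (avoids-root j) (avoids-root j′)
             (opposite-suc-< i) (opposite-suc-< i′) e
    ... | opp≡ , e₀ = enum-injective
                        (pendent-determined-by-start R (pendent j) (pendent j′) (avoids-root j) (avoids-root j′) e₀)
                    , Fin.suc-injective (opposite-injective opp≡)

    extension = extend-arms root a a-injective (λ j i → avoids-root j _ (opposite-suc-< i)) G

    φ : SVertex n k r ↔ Fin n
    φ = proj₁ extension

    φ-arm : ∀ j i → Inverse.to φ (arm j i) ≡ a j i
    φ-arm = proj₂ (proj₂ extension)

  pendentArms : ArmSystem k r R
  pendentArms = record
    { labelling  = φ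
    ; at-centre  = proj₁ (proj₂ extension)
    ; arm-parent = λ {j} {i} {i′} e → trans (cong parent (φ-arm j i′))
        (trans (ascend (pendent j) R (avoids-root j) (opposite-suc-< i′) (opposite-step (cong suc e)))
               (sym (φ-arm j i)))
    ; arm-child  = child
    }
    where
    child : ∀ {v j i} → v ≢ root → parent v ≡ Inverse.to φ (arm j i) →
            ∃ λ i′ → toℕ i′ ≡ suc (toℕ i) × v ≡ Inverse.to φ (arm j i′)
    child {v} {j} {i} v≢ pv≡
      with descend (pendent j) R (avoids-root j) (opposite-suc-< i) v≢ (trans pv≡ (φ-arm j i))
    ... | t , t≡ , v≡ = next (Fin.opposite t) (Fin.opposite-involutive t)
           (trans (opposite-step (sym t≡)) (cong (suc ∘ toℕ) (Fin.opposite-involutive (suc i))))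
      where
      next : ∀ d → Fin.opposite d ≡ t → toℕ d ≡ suc (suc (toℕ i)) →
             ∃ λ i′ → toℕ i′ ≡ suc (toℕ i) × v ≡ Inverse.to φ (arm j i′)
      next (suc i′) d≡ e = i′ , suc-injective e ,
        trans v≡ (trans (cong (lookup (enum j)) (sym d≡)) (sym (φ-arm j i′)))

module _ {n k r : ℕ} (T : Tree n) (paths : HasPendentPaths k r T) where
  open Tree T
  open Exactly paths

  private
    pendent : ∀ j → IsPendentPath graph {r} (enum j)
    pendent j = Equivalence.from (enum-image (enum j)) (j , refl)

  -- Rooting the tree at an arbitrary vertex outside the pendent paths (there is one, as
  -- k * r < n) orients all of them, which shows that no end of one is interior to another.
  pendent-end-not-interior : k * r < n → 1 ≤ r → ∀ j j′ s → toℕ s < r → lookup (enum j) s ≢ last (enum j′)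
  pendent-end-not-interior kr<n 1≤r j j′ s s<r meets with Fin.¬∀⟶∃¬ n Interior Interior? not-all
    where
    Interior : Fin n → Set
    Interior v = ∃ λ j → ∃ λ i → lookup (enum j) (Fin.inject₁ i) ≡ v
    Interior? : U.Decidable Interior
    Interior? v = Fin.any? λ j → Fin.any? λ i → lookup (enum j) (Fin.inject₁ i) Fin.≟ v
    interiors : List (Fin n)
    interiors = map (uncurry λ j i → lookup (enum j) (Fin.inject₁ i)) (cartesianProduct (allFin k) (allFin r))
    length-interiors : length interiors ≡ k * r
    length-interiors = length-map-grid (uncurry λ j i → lookup (enum j) (Fin.inject₁ i))
    not-all : ¬ (∀ v → Interior v)
    not-all all = <⇒≱ kr<n (subst₂ _≤_ (length-allFin graph) length-interiors
      (unique-length-≤ (Unique.allFin⁺ n) λ {v} _ → listed (all v)))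
      where
      listed : ∀ {v} → Interior v → v ∈ interiors
      listed (j , i , refl) =
        ∈-map⁺ (uncurry λ j i → lookup (enum j) (Fin.inject₁ i)) (∈-cartesianProduct⁺ (∈-allFin j) (∈-allFin i))
  ... | ρ , exterior = <-irrefl s≡r s<r
    where
    R : Rooted graph
    R = tree⇒rooted T ρ
    open Rooted R
    avoids : ∀ j s → toℕ s < r → lookup (enum j) s ≢ root
    avoids j s s<r e = exterior (j , Fin.fromℕ< s<r ,
      trans (cong (lookup (enum j)) (Fin.toℕ-injective (trans (Fin.toℕ-inject₁ _) (Fin.toℕ-fromℕ< s<r)))) e)
    t : Fin (suc r)
    t = Fin.fromℕ< {r ∸ 1} (s≤s (m∸n≤m r 1))
    1+t≡r : suc (toℕ t) ≡ r
    1+t≡r = trans (cong suc (Fin.toℕ-fromℕ< _)) (m+[n∸m]≡n 1≤r)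
    -- The vertex just before the end of path `j′` has that end as its parent, so it is a child of
    -- position `s` on path `j`, which must be position `s - 1`. Equality of indices then gives
    -- `r - 1` and `s - 1` the same value.
    below : ∃ λ t′ → suc (toℕ t′) ≡ toℕ s × lookup (enum j′) t ≡ lookup (enum j) t′
    below = descend (pendent j) R (avoids j) s<r (avoids j′ t (≤-reflexive 1+t≡r))
      (trans (ascend (pendent j′) R (avoids j′) (≤-reflexive 1+t≡r) (trans (Fin.toℕ-fromℕ r) (sym 1+t≡r)))
             (trans (lookup-last (enum j′)) (sym meets)))
    s≡r : toℕ s ≡ r
    s≡r with below
    ... | t′ , t′≡ , e with pendent-meet-same-index R (pendent j′) (pendent j) (avoids j′) (avoids j)
                             (≤-reflexive 1+t≡r) (<-trans (≤-reflexive t′≡) s<r) e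
    ...   | refl , _ = trans (sym t′≡) 1+t≡r

-- The extremal tree

module _ {n k r : ℕ} where

  starParent : SVertex n k r → SVertex n k r
  starParent (arm j (suc i)) = arm j (Fin.inject₁ i)
  starParent _               = centre

  starHeight : SVertex n k r → ℕ
  starHeight centre    = 0
  starHeight (arm _ i) = suc (toℕ i)
  starHeight (leaf _)  = 1

  SEdge⇒parent : ∀ {x y : SVertex n k r} → SEdge x y → y ≢ centre × starParent y ≡ x
  SEdge⇒parent (centre–arm {i = zero} _)           = (λ ()) , refl
  SEdge⇒parent (arm–arm {j} {i} {suc i′} e) = (λ ()) ,
    cong (arm j) (Fin.toℕ-injective (trans (Fin.toℕ-inject₁ i′) (suc-injective e)))
  SEdge⇒parent centre–leaf                         = (λ ()) , refl

  parent⇒SEdge : ∀ {y : SVertex n k r} → y ≢ centre → SEdge (starParent y) y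
  parent⇒SEdge {centre}        y≢ = contradiction refl y≢
  parent⇒SEdge {arm _ zero}    _  = centre–arm refl
  parent⇒SEdge {arm _ (suc i)} _  = arm–arm (cong suc (sym (Fin.toℕ-inject₁ i)))
  parent⇒SEdge {leaf _}        _  = centre–leaf

  starRooted : Rooted (S n k r)
  starRooted = record
    { root            = centre
    ; parent          = starParent
    ; height          = starHeight
    ; parent-root     = refl
    ; parent-adjacent = bwd ∘ parent⇒SEdge
    ; height-parent   = height-parent
    ; adjacent⇒parent = λ { (fwd e) → inj₂ (SEdge⇒parent e) ; (bwd e) → inj₁ (SEdge⇒parent e) }
    }
    where
    height-parent : ∀ {x} → x ≢ centre → starHeight x ≡ suc (starHeight (starParent x))
    height-parent {centre}        x≢ = contradiction refl x≢
    height-parent {arm _ zero}    _  = refl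
    height-parent {arm _ (suc i)} _  = cong (λ m → suc (suc m)) (sym (Fin.toℕ-inject₁ i))
    height-parent {leaf _}        _  = refl

module _ {V W : Set} (φ : V ↔ W) (G : SimpleGraph V) where
  open SimpleGraph G
  open Inverse φ

  -- Maximality compares only trees on `Fin n`, so the star has to be moved there.
  relabel : SimpleGraph W
  relabel = record
    { _∼_      = λ u v → from u ∼ from v
    ; ∼-sym    = ∼-sym
    ; ∼-irrefl = λ { refl → ∼-irrefl refl }
    ; _∼?_     = λ u v → from u ∼? from v
    }

  relabelRooted : Rooted G → Rooted relabel
  relabelRooted R = record
    { root            = to root
    ; parent          = to ∘ parent ∘ from
    ; height          = height ∘ from
    ; parent-root     = cong to (trans (cong parent (strictlyInverseʳ root)) parent-root)
    ; parent-adjacent = λ v≢ → subst (_ ∼_) (sym (strictlyInverseʳ _)) (parent-adjacent (from≢ v≢))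
    ; height-parent   = λ v≢ → trans (height-parent (from≢ v≢)) (cong (suc ∘ height) (sym (strictlyInverseʳ _)))
    ; adjacent⇒parent = λ {u} {v} a → orient (adjacent⇒parent a)
    }
    where
    open Rooted R
    from≢ : ∀ {v} → v ≢ to root → from v ≢ root
    from≢ v≢ e = v≢ (trans (sym (strictlyInverseˡ _)) (cong to e))
    to≢ : ∀ {v} → from v ≢ root → v ≢ to root
    to≢ v≢ refl = v≢ (strictlyInverseʳ root)
    above : ∀ {u v} → parent (from u) ≡ from v → to (parent (from u)) ≡ v
    above e = trans (cong to e) (strictlyInverseˡ _)
    orient : ∀ {u v} → (from u ≢ root × parent (from u) ≡ from v) ⊎ (from v ≢ root × parent (from v) ≡ from u) →
             (u ≢ to root × to (parent (from u)) ≡ v) ⊎ (v ≢ to root × to (parent (from v)) ≡ u)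
    orient (inj₁ (u≢ , e)) = inj₁ (to≢ u≢ , above e)
    orient (inj₂ (v≢ , e)) = inj₂ (to≢ v≢ , above e)

module _ {n k r : ℕ} {G : SimpleGraph (Fin n)} {R : Rooted G} (A : ArmSystem k r R) where
  open SimpleGraph G
  open Rooted R
  open ArmSystem A

  arm-end-degree : ∀ {j i} → suc (toℕ i) ≡ r → degree G (at (arm j i)) ≡ 1
  arm-end-degree {j} {i} e = count-≡ G (at (arm j i) ∼?_) {parent (at (arm j i)) ∷ []} ([] ∷ [])
    (λ { (here refl) → parent-adjacent (at≢root λ ()) }) only
    where
    only : ∀ {v} → at (arm j i) ∼ v → v ∈ parent (at (arm j i)) ∷ []
    only a with adjacent⇒parent a
    ... | inj₁ (_ , p≡)  = here (sym p≡)
    ... | inj₂ (v≢ , p≡) with arm-child v≢ p≡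
    ...   | i′ , i′≡ , _ = contradiction (trans i′≡ e) (<⇒≢ (Fin.toℕ<n i′))

  arm-interior-degree : ∀ {j i} → suc (toℕ i) < r → degree G (at (arm j i)) ≡ 2
  arm-interior-degree {j} {i} lt =
    count-≡ G (at (arm j i) ∼?_) {parent (at (arm j i)) ∷ at (arm j i⁺) ∷ []} ((p≢ ∷ []) ∷ [] ∷ [])
      (λ { (here refl)         → parent-adjacent (at≢root λ ())
         ; (there (here refl)) → ∼-sym (subst (at (arm j i⁺) ∼_) (arm-parent i⁺≡) (parent-adjacent (at≢root λ ()))) })
      only
    where
    i⁺ : Fin r
    i⁺ = Fin.fromℕ< lt
    i⁺≡ : toℕ i⁺ ≡ suc (toℕ i)
    i⁺≡ = Fin.toℕ-fromℕ< lt
    p≢ : parent (at (arm j i)) ≢ at (arm j i⁺)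
    p≢ e = grandparent-≢ {at (arm j i)} (at≢root λ ()) (trans (cong parent e) (arm-parent i⁺≡))
    only : ∀ {v} → at (arm j i) ∼ v → v ∈ parent (at (arm j i)) ∷ at (arm j i⁺) ∷ []
    only a with adjacent⇒parent a
    ... | inj₁ (_ , p≡)  = here (sym p≡)
    ... | inj₂ (v≢ , p≡) with arm-child v≢ p≡
    ...   | i′ , i′≡ , v≡ = there (here (trans v≡ (cong (at ∘ arm j) (Fin.toℕ-injective (trans i′≡ (sym i⁺≡))))))

module _ {A : Set} where

  linked-tabulate : ∀ {R : A → A → Set} {m} {f : Fin m → A} →
                    (∀ {s t} → toℕ t ≡ suc (toℕ s) → R (f s) (f t)) → Linked R (Vec.tabulate f)
  linked-tabulate {m = zero}        _    = []
  linked-tabulate {m = suc zero}    _    = [-]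
  linked-tabulate {m = suc (suc m)} step = step {zero} {suc zero} refl ∷ linked-tabulate (step ∘ cong suc)

-- The number bounded by `3≤` counts the arms and leaves at the centre. With a centre of degree two,
-- as for one arm and one leaf, the star would be a path graph and could have additional pendent
-- paths.
module StarTree {n k r′ : ℕ} (labelling : SVertex n k (suc (suc r′)) ↔ Fin n)
  (3≤ : 3 ≤ k + (n ∸ k * suc (suc r′) ∸ 1)) where

  private
    r : ℕ
    r = suc (suc r′)

  open Inverse labelling using () renaming
      (to to at; from to label; strictlyInverseʳ to label-at; strictlyInverseˡ to at-label)

  star : SimpleGraph (Fin n)
  star = relabel labelling (S n k r)

  rooted : Rooted star
  rooted = relabelRooted labelling (S n k r) starRooted

  open Rooted rooted

  private
    at-≡ : ∀ {v x} → label v ≡ x → v ≡ at x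
    at-≡ {v} e = trans (sym (at-label v)) (cong at e)

    parent-at : ∀ x → parent (at x) ≡ at (starParent x)
    parent-at x = cong (at ∘ starParent) (label-at x)

  starArms : ArmSystem k r rooted
  starArms = record
    { labelling  = labelling
    ; at-centre  = refl
    ; arm-parent = λ e → trans (parent-at _) (cong at (proj₂ (SEdge⇒parent (arm–arm e))))
    ; arm-child  = λ {v} v≢ e → child (label v) refl
        (trans (sym (label-at _)) (trans (cong label e) (label-at _)))
    }
    where
    child : ∀ {v j i} x → label v ≡ x → starParent (label v) ≡ arm j i →
            ∃ λ i′ → toℕ i′ ≡ suc (toℕ i) × v ≡ at (arm j i′)
    child {v} x e p with label v in lv
    child (arm j (suc i)) refl refl | arm _ _ = suc i , cong suc (sym (Fin.toℕ-inject₁ i)) , at-≡ lv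

  private
    open ArmSystem starArms using (at-injective; at≢root)

    firsts neighbours : List (SVertex n k r)
    firsts     = map (λ j → arm j zero) (allFin k)
    neighbours = firsts ++ leaves

    first⁻ : ∀ {x} → x ∈ firsts → ∃ λ j → x ≡ arm j zero
    first⁻ x∈ with ∈-map⁻ (λ j → arm j zero) x∈
    ... | j , _ , x≡ = j , x≡

    neighbours! : Unique neighbours
    neighbours! = Unique.++⁺ (Unique.map⁺ (proj₁ ∘ arm-injective) (Unique.allFin⁺ k))
                             leaves!
      λ (x∈f , x∈l) → contradiction (trans (sym (proj₂ (first⁻ x∈f))) (proj₂ (leaves⁻ x∈l))) λ ()

    neighbours-adjacent : ∀ {x} → x ∈ neighbours → SEdge centre x
    neighbours-adjacent x∈ with ∈-++⁻ firsts x∈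
    ... | inj₁ x∈f with _ , refl ← first⁻ x∈f = centre–arm refl
    ... | inj₂ x∈l with _ , refl ← leaves⁻ x∈l  = centre–leaf

    length-neighbours : length neighbours ≡ k + (n ∸ k * r ∸ 1)
    length-neighbours = trans (length-++ firsts) (cong₂ _+_
      (trans (length-map (λ j → arm {n} {k} {r} j zero) (allFin k)) (length-tabulate {n = k} id))
      (length-leaves {n} {k} {r}))

    root-degree : 3 ≤ degree star root
    root-degree = ≤-trans (subst (3 ≤_) (sym (trans (length-map at neighbours) length-neighbours)) 3≤)
      (count-≥ star (root ∼?_) (Unique.map⁺ at-injective neighbours!) adjacent)
      where
      open SimpleGraph star
      adjacent : ∀ {v} → v ∈ map at neighbours → root ∼ v
      adjacent v∈ with ∈-map⁻ at v∈
      ... | x , x∈ , refl = subst₂ (SymClosure SEdge) (sym (label-at centre)) (sym (label-at x))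
                              (fwd (neighbours-adjacent x∈))

    armAt : Fin k → Fin (suc r) → SVertex n k r
    armAt j zero    = centre
    armAt j (suc d) = arm j d

    armAt-step : ∀ {j d d′} → toℕ d′ ≡ suc (toℕ d) → SEdge (armAt j d) (armAt j d′)
    armAt-step {d = zero}  {suc _} e = centre–arm (suc-injective e)
    armAt-step {d = suc _} {suc _} e = arm–arm (suc-injective e)

    armAt-injective : ∀ {j d d′} → armAt j d ≡ armAt j d′ → d ≡ d′
    armAt-injective {d = zero}  {zero}  _ = refl
    armAt-injective {d = suc _} {suc _} e = cong suc (proj₂ (arm-injective e))

    pathAt : Fin k → Fin (suc r) → Fin n
    pathAt j s = at (armAt j (Fin.opposite s))

    path : Fin k → Vec (Fin n) (suc r)
    path j = Vec.tabulate (pathAt j)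

    opposite-top : ∀ m → Fin.opposite (Fin.fromℕ m) ≡ zero
    opposite-top m = Fin.opposite-involutive {suc m} zero

    path-end : ∀ j → last (path j) ≡ root
    path-end j = trans (sym (lookup-last (path j)))
      (trans (lookup∘tabulate (pathAt j) (Fin.fromℕ r)) (cong (at ∘ armAt j) (opposite-top r)))

    path-pendent : ∀ j → IsPendentPath star {r} (path j)
    path-pendent j = record
      { isPath   = linked-tabulate (λ e → subst₂ (SymClosure SEdge) (sym (label-at _)) (sym (label-at _))
                                     (bwd (armAt-step (opposite-step e))))
                 , VecUnique.tabulate⁺ (opposite-injective ∘ armAt-injective ∘ at-injective)
      ; start    = arm-end-degree starArms (cong suc (Fin.toℕ-fromℕ (suc r′)))
      ; end      = subst (λ v → 2 ≤ degree star v) (sym (path-end j)) (≤-trans (n≤1+n 2) root-degree)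
      ; internal = λ s 1≤s s<r → trans (cong (degree star) (lookup∘tabulate (pathAt j) s))
                     (interior (Fin.opposite s) (subst (0 <_) (sym (Fin.opposite-prop s)) (m<n⇒0<n∸m s<r))
                       (subst (_< r) (sym (Fin.opposite-prop s)) (∸-monoʳ-< 1≤s (<⇒≤ s<r))))
      }
      where
      interior : ∀ d → 0 < toℕ d → toℕ d < r → degree star (at (armAt j d)) ≡ 2
      interior (suc d) _ d<r = arm-interior-degree starArms d<r

    path-injective : Injective _≡_ _≡_ path
    path-injective e = proj₁ (arm-injective (at-injective (cong head e)))

    module _ {w : Vec (Fin n) (suc r)} (pendent : IsPendentPath star {r} w) where

      -- Before its end a pendent path has only vertices of degree one or two.
      avoids-root : ∀ s → toℕ s < r → lookup w s ≢ root
      avoids-root zero    _   e = <⇒≱ root-degree (≤-trans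
        (≤-reflexive (trans (cong (degree star) (sym e)) (pendent-start pendent))) (s≤s z≤n))
      avoids-root (suc s) s<r e = <⇒≱ root-degree
        (≤-reflexive (trans (cong (degree star) (sym e)) (IsPendentPath.internal pendent (suc s) (s≤s z≤n) s<r)))

      follows : ∀ j → lookup w zero ≡ pathAt j zero → ∀ m {s} → toℕ s ≡ m → lookup w s ≡ pathAt j s
      follows j e₀ zero    {zero}  _ = e₀
      follows j e₀ (suc m) {suc s} e = begin
        lookup w (suc s)                    ≡⟨ ascend pendent rooted avoids-root s<r s≡ ⟨
        parent (lookup w (Fin.inject₁ s))   ≡⟨ cong parent (follows j e₀ m (trans (Fin.toℕ-inject₁ s) (suc-injective e))) ⟩
        parent (pathAt j (Fin.inject₁ s))   ≡⟨ parent-at _ ⟩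
        at (starParent (armAt j (Fin.opposite (Fin.inject₁ s))))
          ≡⟨ cong at (proj₂ (SEdge⇒parent (armAt-step (opposite-step {s = Fin.inject₁ s} {suc s} s≡)))) ⟩
        pathAt j (suc s)                    ∎
        where
        open ≡-Reasoning
        s≡ : suc (toℕ s) ≡ suc (toℕ (Fin.inject₁ s))
        s≡ = cong suc (sym (Fin.toℕ-inject₁ s))
        s<r : toℕ (Fin.inject₁ s) < r
        s<r = subst (_< r) (sym (Fin.toℕ-inject₁ s)) (Fin.toℕ<n s)

      -- From a leaf the second vertex would be the centre, which is too early because `r` is at
      -- least two. Inner arm vertices have degree two and cannot be starts.
      starts-at-arm-end : ∃ λ j → lookup w zero ≡ pathAt j zero
      starts-at-arm-end with label (lookup w zero) in lv
      ... | centre  = contradiction (at-≡ lv) (avoids-root zero (s≤s z≤n))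
      ... | leaf l  = contradiction
              (trans (sym (ascend pendent rooted avoids-root {zero} {suc zero} (s≤s z≤n) refl))
                     (trans (cong parent (at-≡ lv)) (parent-at (leaf l))))
              (avoids-root (suc zero) (s≤s (s≤s z≤n)))
      ... | arm j i with m≤n⇒m<n∨m≡n (Fin.toℕ<n i)
      ...   | inj₁ i⁺<r with () ← trans (sym (pendent-start pendent))
                                    (trans (cong (degree star) (at-≡ lv)) (arm-interior-degree starArms i⁺<r))
      ...   | inj₂ i⁺≡r = j , trans (at-≡ lv) (cong (at ∘ arm j)
                (Fin.toℕ-injective (trans (suc-injective i⁺≡r) (sym (Fin.toℕ-fromℕ (suc r′))))))

      is-path : ∃ λ j → path j ≡ w
      is-path with starts-at-arm-end
      ... | j , e₀ = j , sym (lookup-extensional λ s → trans (follows j e₀ _ refl) (sym (lookup∘tabulate (pathAt j) s)))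

  starTree : Tree n
  starTree = record
    { graph     = star
    ; connected = rooted⇒connected Fin._≟_ rooted
    ; acyclic   = rooted⇒acyclic Fin._≟_ rooted
    }

  starTree-paths : HasPendentPaths k r starTree
  starTree-paths = record
    { enum           = path
    ; enum-injective = path-injective
    ; enum-image     = λ w → mk⇔ is-path (λ { (j , refl) → path-pendent j })
    }

  leaf-childless : ∀ {l v} → v ≢ root → parent v ≢ at (leaf l)
  leaf-childless {l} {v} _ e = not-leaf (label v) (trans (sym (label-at _)) (trans (cong label e) (label-at _)))
    where
    not-leaf : ∀ x → starParent x ≢ leaf l
    not-leaf (arm _ zero)    ()
    not-leaf (arm _ (suc _)) ()

-- Comparison with the extremal tree

-- The gap plus twice the smaller number is `a + b`. With `c` equal to one or two this gives the
-- bounds `n - 2` and `n - 4` on imbalances.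
gap-bound : ∀ {n a b c} → c ≤ a → c ≤ b → a + b ≤ n → ∣ a - b ∣ + (c + c) ≤ n
gap-bound {n} {a} {b} {c} c≤a c≤b a+b≤n with ≤-total a b
... | inj₁ a≤b = begin
  ∣ a - b ∣ + (c + c)   ≤⟨ +-mono-≤ (≤-reflexive (m≤n⇒∣m-n∣≡n∸m a≤b)) (+-mono-≤ c≤a c≤a) ⟩
  (b ∸ a) + (a + a)     ≡⟨ +-assoc (b ∸ a) a a ⟨
  (b ∸ a) + a + a       ≡⟨ cong (_+ a) (m∸n+n≡m a≤b) ⟩
  b + a                 ≡⟨ +-comm b a ⟩
  a + b                 ≤⟨ a+b≤n ⟩
  n                     ∎
  where open ≤-Reasoning
... | inj₂ b≤a = begin
  ∣ a - b ∣ + (c + c)   ≤⟨ +-mono-≤ (≤-reflexive (m≤n⇒∣n-m∣≡n∸m b≤a)) (+-mono-≤ c≤b c≤b) ⟩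
  (a ∸ b) + (b + b)     ≡⟨ +-assoc (a ∸ b) b b ⟨
  (a ∸ b) + b + b       ≡⟨ cong (_+ b) (m∸n+n≡m b≤a) ⟩
  a + b                 ≤⟨ a+b≤n ⟩
  n                     ∎
  where open ≤-Reasoning

-- Identifies with `n - 2` the form in which `mostar-cut` yields the imbalance of a pendent edge.
pendent-gap : ∀ {n} → 2 ≤ n → ∣ 1 - (n ∸ 1) ∣ + 2 ≡ n
pendent-gap {suc (suc n)} (s≤s (s≤s z≤n)) = +-comm n 2

module _ {n : ℕ} (G : SimpleGraph (Fin n)) (connected : Connected G) where
  open SimpleGraph G

  imbalance-≤ : 2 ≤ n → ∀ {u v} → u ≢ v → imbalance G connected u v ≤ ∣ 1 - (n ∸ 1) ∣
  imbalance-≤ 2≤n {u} {v} u≢v = +-cancelʳ-≤ 2 (imbalance G connected u v) ∣ 1 - (n ∸ 1) ∣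
    (subst (imbalance G connected u v + 2 ≤_) (sym (pendent-gap 2≤n))
      (gap-bound (closer-≥1 G connected u≢v) (closer-≥1 G connected (u≢v ∘ sym)) (closer-+-≤ G connected u v)))

  -- A second neighbour at each end puts at least two vertices on each side, so the imbalance is at
  -- most `n - 4`.
  imbalance-< : Acyclic G → 2 ≤ n → ∀ {u v a b} → u ∼ v → u ∼ a → a ≢ v → v ∼ b → b ≢ u →
                imbalance G connected u v < ∣ 1 - (n ∸ 1) ∣
  imbalance-< acyclic 2≤n {u} {v} u∼v u∼a a≢v v∼b b≢u = +-cancelʳ-≤ 2 _ ∣ 1 - (n ∸ 1) ∣
    (≤-trans (subst (_≤ imbalance G connected u v + 4) (+-suc (imbalance G connected u v) 2)
               (+-monoʳ-≤ (imbalance G connected u v) (n≤1+n 3)))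
    (subst (imbalance G connected u v + 4 ≤_) (sym (pendent-gap 2≤n))
      (gap-bound (closer-≥2 G connected acyclic u∼v u∼a a≢v) (closer-≥2 G connected acyclic (∼-sym u∼v) v∼b b≢u)
        (closer-+-≤ G connected u v))))

  childless-imbalance : (R : Rooted G) (let open Rooted R) → ∀ {v} → v ≢ root →
                        (∀ {c} → c ≢ root → parent c ≢ v) →
                        imbalance G connected v (parent v) ≡ ∣ 1 - (n ∸ 1) ∣
  childless-imbalance R {v} v≢ childless =
    mostar-cut G connected {v ∷ []} ([] ∷ []) (here refl) (λ { (here e) → parent-≢ v≢ e }) λ where
      a (here refl) y∉ → refl , only-parent (adjacent⇒parent a)
    where
    open Rooted R
    only-parent : ∀ {y} → (v ≢ root × parent v ≡ y) ⊎ (y ≢ root × parent y ≡ v) → y ≡ parent v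
    only-parent (inj₁ (_ , p≡))  = sym p≡
    only-parent (inj₂ (y≢ , p≡)) = contradiction p≡ (childless y≢)

module _ {n : ℕ} {G : SimpleGraph (Fin n)} where
  open SimpleGraph G

  another-neighbour : ∀ {u} → 2 ≤ degree G u → ∀ v → ∃ λ a → u ∼ a × a ≢ v
  another-neighbour {u} 2≤ v with Fin.any? (λ a → (u ∼? a) ×-dec ¬? (a Fin.≟ v))
  ... | yes found = found
  ... | no  none  = contradiction 2≤ (<⇒≱ (s≤s (count-≤ G (u ∼?_) {v ∷ []} λ {a} u∼a →
    here (decidable-stable (a Fin.≟ v) λ a≢v → none (a , u∼a , a≢v)))))

  module _ {k r : ℕ} {R : Rooted G} (A : ArmSystem k r R) where
    open Rooted R
    open ArmSystem A

    -- No leaf-labelled vertex is a parent, and an arm vertex is the parent of at most its successor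
    -- on the arm. First arm vertices and leaf-labelled ones can therefore hang only from the
    -- centre, which makes `parent` agree with `starParent`.
    childless-leaves⇒≅ : (∀ l {c} → c ≢ root → parent c ≢ at (leaf l)) → G ≅ S n k r
    childless-leaves⇒≅ childless = record
      { bijection = ↔-sym labelling
      ; adjacent  = λ u v → mk⇔ (to ∘ adjacent⇒parent) from
      }
      where
      parent-at : ∀ x → x ≢ centre → parent (at x) ≡ at (starParent x)
      parent-at x x≢ with label (parent (at x)) in lp
      ... | y = trans (sym (at-label _)) (cong at (trans lp (label-parent x y x≢ (trans (sym (at-label _)) (cong at lp)))))
        where
        label-parent : ∀ x y → x ≢ centre → parent (at x) ≡ at y → y ≡ starParent x
        label-parent centre          _         x≢ _ = contradiction refl x≢
        label-parent (arm j (suc i)) y         _  e = at-injective (trans (sym e) (arm-parent (cong suc (sym (Fin.toℕ-inject₁ i)))))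
        label-parent x               (leaf l)  x≢ e = contradiction e (childless l (at≢root x≢))
        label-parent (arm j zero)    centre    _  _ = refl
        label-parent (leaf l)        centre    _  _ = refl
        label-parent x               (arm j i) x≢ e with arm-child (at≢root x≢) e
        ... | suc i′ , i′≡ , x≡ with refl ← at-injective x≡ =
          cong (arm j) (Fin.toℕ-injective (trans (sym (suc-injective i′≡)) (sym (Fin.toℕ-inject₁ i′))))

      label≢ : ∀ {v} → v ≢ root → label v ≢ centre
      label≢ v≢ e = v≢ (trans (sym (at-label _)) (trans (cong at e) at-centre))

      label-parent≡ : ∀ {v} → v ≢ root → label (parent v) ≡ starParent (label v)
      label-parent≡ {v} v≢ = at-injective (trans (at-label _)
        (trans (cong parent (sym (at-label v))) (parent-at (label v) (label≢ v≢))))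

      edge : ∀ {v} → v ≢ root → SEdge (label (parent v)) (label v)
      edge v≢ = subst (λ x → SEdge x _) (sym (label-parent≡ v≢)) (parent⇒SEdge (label≢ v≢))

      to : ∀ {u v} → (u ≢ root × parent u ≡ v) ⊎ (v ≢ root × parent v ≡ u) → SymClosure SEdge (label u) (label v)
      to (inj₁ (u≢ , refl)) = bwd (edge u≢)
      to (inj₂ (v≢ , refl)) = fwd (edge v≢)

      below : ∀ {u v} → SEdge (label u) (label v) → v ∼ u
      below {u} {v} e with SEdge⇒parent e
      ... | lv≢ , p≡ = subst (v ∼_) pv≡u (parent-adjacent v≢)
        where
        v≢ : v ≢ root
        v≢ refl = lv≢ (at-injective (trans (at-label _) (sym at-centre)))
        pv≡u : parent v ≡ u
        pv≡u = trans (sym (at-label _)) (trans (cong at (trans (label-parent≡ v≢) p≡)) (at-label u))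

      from : ∀ {u v} → SymClosure SEdge (label u) (label v) → u ∼ v
      from (fwd e) = ∼-sym (below e)
      from (bwd e) = below e

module _ {n k r′ : ℕ} (labelling : SVertex n k (suc (suc r′)) ↔ Fin n)
         (3≤ : 3 ≤ k + (n ∸ k * suc (suc r′) ∸ 1)) (2≤n : 2 ≤ n) where

  private
    r : ℕ
    r = suc (suc r′)

  open StarTree labelling 3≤

  module _ (T : Tree n) {R : Rooted (Tree.graph T)} (A : ArmSystem k r R) where
    open Tree T
    open Rooted R
    open ArmSystem A

    private
      weight weight* : SVertex n k r → ℕ
      weight  = parent-imbalance graph connected A
      weight* = parent-imbalance star (Tree.connected starTree) starArms

      weight*-leaf : ∀ l → weight* (leaf l) ≡ ∣ 1 - (n ∸ 1) ∣
      weight*-leaf l = childless-imbalance star (Tree.connected starTree) rooted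
        (ArmSystem.at≢root starArms λ ()) leaf-childless

      weight-≤ : ∀ {x} → x ∈ nonCentre → weight x ≤ weight* x
      weight-≤ {centre}  x∈ = contradiction x∈ centre∉
      weight-≤ {arm j i} _  = ≤-reflexive (trans (arm-imbalance graph connected A j i)
                                (sym (arm-imbalance star (Tree.connected starTree) starArms j i)))
      weight-≤ {leaf l}  _  = subst (weight (leaf l) ≤_) (sym (weight*-leaf l))
                                (imbalance-≤ graph connected 2≤n (parent-≢ (at≢root λ ()) ∘ sym))

    -- Maximality forces equality in each term, so the edge above a leaf-labelled vertex has
    -- imbalance `n - 2`. A child below it would give this edge a further neighbour at both ends,
    -- and the imbalance would be smaller.
    maximal⇒childless-leaves : treeMostar starTree ≤ treeMostar T → 2 ≤ degree graph root →
                               ∀ l {c} → c ≢ root → parent c ≢ at (leaf l)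
    maximal⇒childless-leaves S≤T 2≤root l {c} c≢ pc≡v = <⇒≱ strict tight
      where
      open SimpleGraph graph
      v : Fin n
      v = at (leaf l)
      v≢ : v ≢ root
      v≢ = at≢root λ ()
      v∼c : v ∼ c
      v∼c = ∼-sym (subst (c ∼_) pc≡v (parent-adjacent c≢))
      c≢pv : c ≢ parent v
      c≢pv e = grandparent-≢ v≢ (trans (cong parent (sym e)) pc≡v)
      -- The second neighbour of the upper end is its own parent; if the upper end is the root, the
      -- degree of the root supplies one.
      sibling : ∃ λ b → parent v ∼ b × b ≢ v
      sibling with parent v Fin.≟ root
      ... | yes pv≡ = another-neighbour {G = graph} (subst (λ u → 2 ≤ degree graph u) (sym pv≡) 2≤root) v
      ... | no  pv≢ = parent (parent v) , parent-adjacent pv≢ , grandparent-≢ v≢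
      strict : weight (leaf l) < ∣ 1 - (n ∸ 1) ∣
      strict = imbalance-< graph connected acyclic 2≤n (parent-adjacent v≢) v∼c c≢pv
                 (proj₁ (proj₂ sibling)) (proj₂ (proj₂ sibling))
      tight : ∣ 1 - (n ∸ 1) ∣ ≤ weight (leaf l)
      tight = subst (_≤ weight (leaf l)) (weight*-leaf l)
        (sum-squeeze nonCentre weight-≤
          (subst₂ _≤_ (mostar-labelled star (Tree.connected starTree) starArms) (mostar-labelled graph connected A) S≤T)
          (leaf∈ l))

  maximal⇒star : k * r < n → 1 ≤ k → (T : Tree n) → IsMostarMaximal k r T → Tree.graph T ≅ S n k r
  maximal⇒star kr<n (s≤s {n = k′} z≤n) T (paths , maximal) =
    childless-leaves⇒≅ A (maximal⇒childless-leaves T A (maximal starTree starTree-paths) 2≤root)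
    where
    open Exactly paths
    -- A pendent path exists because `k` is positive. Its end has degree at least two by definition
    -- and, by `pendent-end-not-interior`, does not precede the end of any pendent path.
    root = last (enum zero)
    A : ArmSystem k r (tree⇒rooted T root)
    A = pendentArms (tree⇒rooted T root) paths λ j s → pendent-end-not-interior T paths kr<n (s≤s z≤n) j zero s
    2≤root : 2 ≤ degree (Tree.graph T) root
    2≤root = IsPendentPath.end (Equivalence.from (enum-image (enum zero)) (zero , refl))

theorem5p1 : (n k r : ℕ) →
    (k ≡ 1 × 2 ≤ r × r + 3 ≤ n) ⊎ (2 ≤ k × 2 ≤ r × k * r + 2 ≤ n) →
    (T : Tree n) → IsMostarMaximal k r T →
    Tree.graph T ≅ S n k r
theorem5p1 n .1 (suc (suc r′)) (inj₁ (refl , s≤s (s≤s z≤n) , r+3≤n)) =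
  maximal⇒star (SVertex↔Fin kr+1≤n) 3≤ (≤-trans (s≤s (s≤s z≤n)) kr+1≤n)
    (subst (_≤ n) (+-comm (1 * r) 1) kr+1≤n) ≤-refl
  where
  r = suc (suc r′)
  kr+3≤n : 1 * r + 3 ≤ n
  kr+3≤n = subst (λ m → m + 3 ≤ n) (sym (*-identityˡ r)) r+3≤n
  kr+1≤n : 1 * r + 1 ≤ n
  kr+1≤n = ≤-trans (+-monoʳ-≤ (1 * r) (s≤s z≤n)) kr+3≤n
  -- One arm and, by `r + 3 ≤ n`, at least two leaves.
  3≤ : 3 ≤ 1 + (n ∸ 1 * r ∸ 1)
  3≤ = s≤s (subst (2 ≤_) (sym (∸-+-assoc n (1 * r) 1))
         (m+n≤o⇒m≤o∸n 2 (subst (_≤ n) (trans (+-comm (1 * r) 3) (cong (λ m → suc (suc m)) (+-comm 1 (1 * r)))) kr+3≤n)))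
theorem5p1 n k (suc (suc r′)) (inj₂ (2≤k , s≤s (s≤s z≤n) , kr+2≤n)) =
  maximal⇒star (SVertex↔Fin kr+1≤n) 3≤ (≤-trans (m≤n+m 2 (k * r)) kr+2≤n)
    (subst (_≤ n) (+-comm (k * r) 1) kr+1≤n) (≤-trans (n≤1+n 1) 2≤k)
  where
  r = suc (suc r′)
  kr+1≤n : k * r + 1 ≤ n
  kr+1≤n = ≤-trans (+-monoʳ-≤ (k * r) (s≤s z≤n)) kr+2≤n
  -- At least two arms and, by `k * r + 2 ≤ n`, at least one leaf.
  3≤ : 3 ≤ k + (n ∸ k * r ∸ 1)
  3≤ = +-mono-≤ 2≤k (subst (1 ≤_) (sym (∸-+-assoc n (k * r) 1))
         (m+n≤o⇒m≤o∸n 1 (subst (_≤ n) (+-suc (k * r) 1) kr+2≤n)))
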